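{- Let $A=(A[1],\dots,A[n])$ be an array of $n$ pairwise distinct real numbers and let $G$ be the corresponding graph of $A$ with reach one. Let $F$ be the resulting DFS forest of $G$ (for a visiting list that is some ordering of all vertices). Merge the sub-trees of $F$ and call the resulting graph $H'$. Let $H_1$ and $R_1$ be the graph and the root list produced by the merge step applied to $H'$ with the list of roots of $F$ (in some order), and let $F_1$ be the resulting DFS forest of $H_1$ with visiting list $R_1$. For $i>1$, let $H_i$ and $R_i$ be the graph and root list produced by the merge step applied to $F_{i-1}$ with root list $R_{i-1}$, and let $F_i$ be the resulting DFS forest of $H_i$ with visiting list $R_i$. Then there exists a finite $i$ such that $F_i$ is a directed Hamiltonian path on all $n$ vertices, and the topological sort of $F_i$ is the sequence of indices of the sorted array of $A$.
   Context: An array is a finite sequence $A=(A[1],\dots,A[n])$ of pairwise distinct real numbers. A comparison graph on $A$ is a directed graph with vertex set $\{1,\dots,n\}$ in which every arc $(u,v)$ satisfies $A[u]<A[v]$. The corresponding graph of $A$ with reach $r\ge1$ is the directed graph on $\{1,\dots,n\}$ having an arc $(i,j)$ for every $i\neq j$ with $A[i]<A[j]$ such that $j\equiv i+k$ or $j\equiv i-k \pmod n$ for some $1\le k\le r$ (indices cyclic). Components of a directed graph are the connected components of its underlying undirected graph. A directed Hamiltonian path of a graph (or of a component) is a directed path visiting each of its vertices exactly once. A topological sort of a directed acyclic graph is an ordering of all vertices such that every arc goes from an earlier to a later vertex. The sequence of indices of the sorted array of $A$ is the permutation $(\sigma_1,\dots,\sigma_n)$ of $\{1,\dots,n\}$ with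 $A[\sigma_1]<\dots<A[\sigma_n]$. DFS: adjacency lists are sorted in increasing order of $A$-value; given a visiting list $(l_1,\dots,l_m)$, for $t=1,\dots,m$, if $l_t$ is unvisited call Visit$(l_t)$, where Visit$(u)$ marks $u$ visited and, for each out-neighbour $w$ of $u$ in increasing order of $A[w]$ that is still unvisited, sets parent$(w)=u$ and calls Visit$(w)$. The resulting DFS forest is the directed graph on the same vertex set with arcs $(\mathrm{parent}(w),w)$; its roots are the vertices without parent. Merging the sub-trees of a DFS forest $F$ of the reach-one corresponding graph: for each component of $F$ whose root has exactly two children $a_1,b_1$, set $p=a_1$, $q=b_1$ and, while both $p,q$ are defined: if $A[p]<A[q]$ add the arc $(p,q)$ and replace $p$ by its smallest-valued child in $F$ (undefined if none); otherwise add the arc $(q,p)$ and replace $q$ by its smallest-valued child in $F$ (undefined if none). Component merge of two distinct components $C,D$ of a comparison graph: set $p,q$ to the minimum-valued vertices of $C,D$; while both are defined: if $A[p]<A[q]$ add the arc $(p,q)$ and replace $p$ by the smallest-valued out-neighbour of $p$ in $C$ (ignoring arcs added during this merge; undefined if none); otherwise add $(q,p)$ and replace $q$ analogously within $D$. Merge step: given a comparison graph whose components each have a minimum-valued vertex (its root) and a list $(\rho_1,\dots,\rho_k)$ of these roots, perform the component merge of the components of $\rho_{2j-1}$ and $\rho_{2j}$ for $j=1,\dots,\lfloor k/2\rfloor$, and return the new root list obtained from $(\rho_1,\dots,\rho_k)$ by deleting, from each merged pair, the root of larger value. -}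

module Defs where

open import Data.Bool.Base using (if_then_else_)
open import Data.Fin.Base as Fin using (Fin; toℕ)
open import Data.Fin.Induction using (spo-noetherian)
open import Data.Fin.Properties as Fin using (any?; all?)
open import Data.Integer.Base as ℤ using (ℤ; +_)
import Data.Integer.Divisibility as ℤ
open import Data.List.Base
  using (List; []; _∷_; _++_; allFin; cartesianProduct; filter; foldl; head; length; lookup)
open import Data.List.Membership.Propositional using (_∈_)
import Data.List.Membership.DecPropositional as DecMembership
open import Data.List.Relation.Binary.Permutation.Propositional using (_↭_; ↭-sym)
open import Data.List.Relation.Binary.Permutation.Propositional.Properties using (All-resp-↭)
open import Data.List.Relation.Unary.All as All using (All; []; _∷_)
open import Data.List.Relation.Unary.All.Properties using (all-filter)
open import Data.List.Relation.Unary.Any using (here; there)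
open import Data.List.Relation.Unary.Linked using (Linked)
import Data.List.Sort
open import Data.Maybe.Base using (Maybe; just; nothing; maybe′)
open import Data.Nat.Base using (ℕ; zero; suc)
import Data.Nat.Divisibility as ℕ
open import Data.Product.Base using (∃; ∃₂; _×_; _,_; proj₁; proj₂)
open import Data.Product.Properties using (≡-dec)
open import Data.Sum.Base using (_⊎_; inj₁; inj₂)
open import Function.Base using (flip; _∘_; case_of_)
open import Function.Bundles using (_⇔_)
open import Induction.WellFounded using (WellFounded; Acc; acc)
open import Level using (Level; 0ℓ; _⊔_)
open import Relation.Binary.Bundles using (StrictTotalOrder; DecTotalOrder)
open import Relation.Binary.Construct.Closure.Equivalence as EqC using (EqClosure)
open import Relation.Binary.Construct.Closure.ReflexiveTransitive using (ε; _◅_)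
open import Relation.Binary.Construct.Closure.Symmetric using (SymClosure; fwd; bwd)
import Relation.Binary.Construct.On as On
open import Relation.Binary.Core using (Rel)
open import Relation.Binary.Definitions using (Decidable; tri<; tri≈; tri>)
import Relation.Binary.Properties.StrictTotalOrder as StrictTotalOrderProperties
open import Relation.Binary.PropositionalEquality using (_≡_; _≢_; refl)
open import Relation.Nullary using (¬_; Dec; does; yes; no; ¬?; _×-dec_; _⊎-dec_)
open import Relation.Nullary.Decidable using (map′)

module _ {n : ℕ} where

  ArcOf : List (Fin n × Fin n) → Rel (Fin n) 0ℓ
  ArcOf as u v = (u , v) ∈ as

  private
    Split : Fin n → Fin n → List (Fin n × Fin n) → Rel (Fin n) 0ℓ
    Split a b as u v =
      u ~ v ⊎ (u ~ a × b ~ v) ⊎ (u ~ b × a ~ v)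
      where
      _~_ : Rel (Fin n) 0ℓ
      _~_ = EqClosure (ArcOf as)

    split⁻ : ∀ {a b as u v} → Split a b as u v → EqClosure (ArcOf ((a , b) ∷ as)) u v
    split⁻ {a} {b} {as} = λ where
        (inj₁ u~v)                → weaken u~v
        (inj₂ (inj₁ (u~a , b~v))) → trans (weaken u~a) (trans a~b (weaken b~v))
        (inj₂ (inj₂ (u~b , a~v))) → trans (weaken u~b) (trans (sym a~b) (weaken a~v))
      where
      weaken : ∀ {x y} → EqClosure (ArcOf as) x y → EqClosure (ArcOf ((a , b) ∷ as)) x y
      weaken = EqC.map there

      trans : ∀ {x y z} → EqClosure (ArcOf ((a , b) ∷ as)) x y →
              EqClosure (ArcOf ((a , b) ∷ as)) y z → EqClosure (ArcOf ((a , b) ∷ as)) x z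
      trans = EqC.transitive _

      sym : ∀ {x y} → EqClosure (ArcOf ((a , b) ∷ as)) x y → EqClosure (ArcOf ((a , b) ∷ as)) y x
      sym = EqC.symmetric _

      a~b : EqClosure (ArcOf ((a , b) ∷ as)) a b
      a~b = EqC.return (here refl)

    split⁺ : ∀ {a b as u v} → EqClosure (ArcOf ((a , b) ∷ as)) u v → Split a b as u v
    split⁺ ε = inj₁ ε
    split⁺ {a} {b} {as} (s ◅ ss) = step s (split⁺ ss)
      where
      prepend : ∀ {x y v} → SymClosure (ArcOf as) x y → Split a b as y v → Split a b as x v
      prepend e (inj₁ y~v)                = inj₁ (e ◅ y~v)
      prepend e (inj₂ (inj₁ (y~a , b~v))) = inj₂ (inj₁ (e ◅ y~a , b~v))
      prepend e (inj₂ (inj₂ (y~b , a~v))) = inj₂ (inj₂ (e ◅ y~b , a~v))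

      step : ∀ {x y v} → SymClosure (ArcOf ((a , b) ∷ as)) x y →
             Split a b as y v → Split a b as x v
      step (fwd (there e))   s                         = prepend (fwd e) s
      step (bwd (there e))   s                         = prepend (bwd e) s
      step (fwd (here refl)) (inj₁ b~v)                = inj₂ (inj₁ (ε , b~v))
      step (fwd (here refl)) (inj₂ (inj₁ (_ , b~v)))   = inj₂ (inj₁ (ε , b~v))
      step (fwd (here refl)) (inj₂ (inj₂ (_ , a~v)))   = inj₁ a~v
      step (bwd (here refl)) (inj₁ a~v)                = inj₂ (inj₂ (ε , a~v))
      step (bwd (here refl)) (inj₂ (inj₁ (_ , b~v)))   = inj₁ b~v
      step (bwd (here refl)) (inj₂ (inj₂ (_ , a~v)))   = inj₂ (inj₂ (ε , a~v))

  eqClosure? : ∀ as → Decidable (EqClosure (ArcOf as))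
  eqClosure? []             u v = map′
    (λ { refl → ε }) (λ { ε → refl ; (fwd () ◅ _) ; (bwd () ◅ _) }) (u Fin.≟ v)
  eqClosure? ((a , b) ∷ as) u v = map′ split⁻ split⁺
    (u ~? v ⊎-dec (u ~? a ×-dec b ~? v) ⊎-dec (u ~? b ×-dec a ~? v))
    where
    _~?_ : Decidable (EqClosure (ArcOf as))
    _~?_ = eqClosure? as

infix 4 _≡_[mod_]

_≡_[mod_] : ℤ → ℤ → ℕ → Set
x ≡ y [mod m ] = + m ℤ.∣ x ℤ.- y

-- The entries of the array are only ever compared with one another, so they
-- may come from any strict total order.  Indices run over 0, …, n - 1.
module ArraySort {a ℓ₁ ℓ₂ : Level} (O : StrictTotalOrder a ℓ₁ ℓ₂)
                 {n : ℕ} (A : Fin n → StrictTotalOrder.Carrier O) where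

  Vertex : Set
  Vertex = Fin n

  byValue : StrictTotalOrder 0ℓ ℓ₁ ℓ₂
  byValue = On.strictTotalOrder O A

  -- u ≺ v is A[u] < A[v].
  open StrictTotalOrder byValue using (compare) renaming (_<_ to _≺_; _<?_ to _≺?_) public

  byValue-decTotalOrder : DecTotalOrder 0ℓ ℓ₁ (ℓ₁ ⊔ ℓ₂)
  byValue-decTotalOrder = StrictTotalOrderProperties.decTotalOrder byValue

  open Data.List.Sort byValue-decTotalOrder public
    using () renaming (sort to sortByValue; sort-↭ to sortByValue-↭; sort-↗ to sortByValue-↗)

  -- Recursion along increasing values terminates, since there are finitely many vertices.
  ≻-wellFounded : WellFounded (flip _≺_)
  ≻-wellFounded = spo-noetherian (StrictTotalOrder.isStrictPartialOrder byValue)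

  IsOrdering : List Vertex → Set
  IsOrdering vs = vs ↭ allFin n

  IsSortedIndices : List Vertex → Set ℓ₂
  IsSortedIndices σ = IsOrdering σ × Linked _≺_ σ

  -- Only membership in the list of arcs matters below, not order or multiplicity.
  record ComparisonGraph : Set ℓ₂ where
    constructor graph
    field
      arcs      : List (Vertex × Vertex)
      ascending : All (λ (u , v) → u ≺ v) arcs

  open ComparisonGraph public

  Arc : ComparisonGraph → Rel Vertex 0ℓ
  Arc G = ArcOf (arcs G)

  arc? : ∀ G → Decidable (Arc G)
  arc? G u v = (u , v) ∈? arcs G
    where open DecMembership (≡-dec Fin._≟_ Fin._≟_) using (_∈?_)

  emptyGraph : ComparisonGraph
  emptyGraph = graph [] []

  addArc : ∀ {u v} → u ≺ v → ComparisonGraph → ComparisonGraph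
  addArc u≺v (graph as as↑) = graph (_ ∷ as) (u≺v ∷ as↑)

  outNeighbours : ComparisonGraph → Vertex → List Vertex
  outNeighbours G u = sortByValue (filter (arc? G u) (allFin n))

  outNeighbours-≻ : ∀ G u → All (u ≺_) (outNeighbours G u)
  outNeighbours-≻ G u = All-resp-↭ (↭-sym (sortByValue-↭ _))
    (All.map (All.lookup (ascending G)) (all-filter (arc? G u) (allFin n)))

  Connected : ComparisonGraph → Rel Vertex 0ℓ
  Connected G = EqClosure (Arc G)

  connected? : ∀ G → Decidable (Connected G)
  connected? G = eqClosure? (arcs G)

  component : ComparisonGraph → Vertex → List Vertex
  component G v = filter (connected? G v) (allFin n)

  minimum : List Vertex → Maybe Vertex
  minimum vs = head (sortByValue vs)

  Root : ComparisonGraph → Vertex → Set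
  Root G v = ∀ u → ¬ Arc G u v

  root? : ∀ G v → Dec (Root G v)
  root? G v = all? λ u → ¬? (arc? G u v)

  roots : ComparisonGraph → List Vertex
  roots G = filter (root? G) (allFin n)

  -- k : Fin r stands for the distance 1 + k ∈ {1, …, r}.
  WithinReach : ℕ → Rel Vertex 0ℓ
  WithinReach r i j = ∃ λ (k : Fin r) → let d = + suc (toℕ k) in
    (+ toℕ j ≡ + toℕ i ℤ.+ d [mod n ]) ⊎ (+ toℕ j ≡ + toℕ i ℤ.- d [mod n ])

  withinReach? : ∀ r → Decidable (WithinReach r)
  withinReach? r i j = any? λ k → (n ℕ.∣? _) ⊎-dec (n ℕ.∣? _)

  CorrespondingArc : ℕ → Vertex × Vertex → Set ℓ₂
  CorrespondingArc r (i , j) = i ≢ j × i ≺ j × WithinReach r i j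

  correspondingArc? : ∀ r ij → Dec (CorrespondingArc r ij)
  correspondingArc? r (i , j) = ¬? (i Fin.≟ j) ×-dec i ≺? j ×-dec withinReach? r i j

  correspondingGraph : ℕ → ComparisonGraph
  correspondingGraph r = graph
    (filter (correspondingArc? r) (cartesianProduct (allFin n) (allFin n)))
    (All.map (proj₁ ∘ proj₂)
      (all-filter (correspondingArc? r) (cartesianProduct (allFin n) (allFin n))))

  -- Setting parent(w) = u is recorded as the arc (u , w) of the forest.
  record DFSState : Set ℓ₂ where
    constructor state
    field
      visited : List Vertex
      forest  : ComparisonGraph

  open DFSState public

  module _ (G : ComparisonGraph) where

    open DecMembership (Fin._≟_ {n}) using (_∈?_)

    visit   : ∀ u → Acc (flip _≺_) u → DFSState → DFSState
    explore : ∀ u → Acc (flip _≺_) u → ∀ ws → All (u ≺_) ws → DFSState → DFSState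

    visit u ac (state vis F) =
      explore u ac (outNeighbours G u) (outNeighbours-≻ G u) (state (u ∷ vis) F)

    explore u ac          []       []           s = s
    explore u ac@(acc rs) (w ∷ ws) (u≺w ∷ u≺ws) s = explore u ac ws u≺ws
      (if does (w ∈? visited s) then s
       else visit w (rs u≺w) (state (visited s) (addArc u≺w (forest s))))

    visitAll : List Vertex → DFSState → DFSState
    visitAll []       s = s
    visitAll (l ∷ ls) s = visitAll ls
      (if does (l ∈? visited s) then s else visit l (≻-wellFounded l) s)

  dfsForest : ComparisonGraph → List Vertex → ComparisonGraph
  dfsForest G ls = forest (visitAll G ls (state [] emptyGraph))

  smallestOutNeighbour : ComparisonGraph → ∀ p → Maybe (∃ (p ≺_))
  smallestOutNeighbour G p with outNeighbours G p | outNeighbours-≻ G p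
  ... | []    | _       = nothing
  ... | p′ ∷ _ | p≺p′ ∷ _ = just (p′ , p≺p′)

  -- Successors are looked up in G, so that the arcs added to H are ignored.  In
  -- every use p and q run through disjoint sets of vertices, so the case of
  -- equal values does not arise.
  mergeLoop : ComparisonGraph → ∀ p q → Acc (flip _≺_) p → Acc (flip _≺_) q →
              ComparisonGraph → ComparisonGraph
  mergeLoop G p q ap@(acc rp) aq@(acc rq) H = case compare p q of λ where
    (tri< p≺q _ _) → maybe′ (λ (p′ , p≺p′) → mergeLoop G p′ q (rp p≺p′) aq (addArc p≺q H))
                            (addArc p≺q H) (smallestOutNeighbour G p)
    (tri≈ _ _ _)   → H
    (tri> _ _ q≺p) → maybe′ (λ (q′ , q≺q′) → mergeLoop G p q′ ap (rq q≺q′) (addArc q≺p H))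
                            (addArc q≺p H) (smallestOutNeighbour G q)

  mergeFrom : ComparisonGraph → Maybe Vertex → Maybe Vertex → ComparisonGraph → ComparisonGraph
  mergeFrom G (just p) (just q) H = mergeLoop G p q (≻-wellFounded p) (≻-wellFounded q) H
  mergeFrom G _        _        H = H

  mergeChildren : ComparisonGraph → ComparisonGraph → Vertex → ComparisonGraph
  mergeChildren F H r with outNeighbours F r
  ... | a₁ ∷ b₁ ∷ [] = mergeFrom F (just a₁) (just b₁) H
  ... | _            = H

  mergeSubtrees : ComparisonGraph → ComparisonGraph
  mergeSubtrees F = foldl (mergeChildren F) F (roots F)

  -- A component is closed under out-neighbours, so looking successors up in G
  -- keeps p and q in the components of u and v.
  componentMerge : ComparisonGraph → Vertex → Vertex → ComparisonGraph
  componentMerge G u v = mergeFrom G (minimum (component G u)) (minimum (component G v)) G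

  mergeStep : ComparisonGraph → List Vertex → ComparisonGraph × List Vertex
  mergeStep G (ρ₁ ∷ ρ₂ ∷ ρs) with mergeStep (componentMerge G ρ₁ ρ₂) ρs | ρ₁ ≺? ρ₂
  ... | H , R | yes _ = H , ρ₁ ∷ R
  ... | H , R | no  _ = H , ρ₂ ∷ R
  mergeStep G ρs = G , ρs

  round : ComparisonGraph × List Vertex → ComparisonGraph × List Vertex
  round (G , R) with mergeStep G R
  ... | H , R′ = dfsForest H R′ , R′

  -- Starting from G = H′ and the roots R of F, the pair (Fᵢ , Rᵢ) for i ≥ 1;
  -- index 0 is the initial pair (H′ , R).
  rounds : ComparisonGraph → List Vertex → ℕ → ComparisonGraph × List Vertex
  rounds G R zero    = G , R
  rounds G R (suc i) = round (rounds G R i)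

  Consecutive : List Vertex → Rel Vertex 0ℓ
  Consecutive π u v = ∃₂ λ xs ys → π ≡ xs ++ u ∷ v ∷ ys

  -- The graph itself is the path; it does not merely contain one.
  IsHamiltonianPath : ComparisonGraph → Set
  IsHamiltonianPath G = ∃ λ π → IsOrdering π × (∀ u v → Arc G u v ⇔ Consecutive π u v)

  Before : List Vertex → Rel Vertex 0ℓ
  Before τ u v = ∃₂ λ (i j : Fin (length τ)) → i Fin.< j × lookup τ i ≡ u × lookup τ j ≡ v

  IsTopologicalSort : ComparisonGraph → List Vertex → Set
  IsTopologicalSort G τ = IsOrdering τ × (∀ u v → Arc G u v → Before τ u v)

  IsTheTopologicalSort : ComparisonGraph → List Vertex → Set
  IsTheTopologicalSort G σ =
    IsTopologicalSort G σ × (∀ τ → IsTopologicalSort G τ → τ ≡ σ)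

{-# OPTIONS --safe #-}
-- Call a set of vertices listed by increasing value a chain of G if consecutive
-- members are joined by arcs and no arc of G enters or leaves it.  In a chain the
-- successor of a vertex is its smallest out-neighbour.  Hence component-merging two
-- chains interleaves them by value into one chain, and DFS from the least vertex of a
-- chain runs straight along it and keeps exactly the arcs between consecutive members.
-- In the forest F every vertex has at most one parent and at most two neighbours, so
-- below a root there are at most two paths; merging them turns each tree into a chain.
-- Each round then replaces k chains by ⌈k/2⌉, until a single directed path is left.

module Submission where

open import Defs
open import Data.Bool.Base using (true; false; if_then_else_)
open import Data.Empty using (⊥-elim)
open import Data.Fin.Base as Fin using (Fin; zero; suc; toℕ)
import Data.Fin.Induction as Fin
import Data.Fin.Properties as Fin
open import Data.Integer.Base as ℤ using (ℤ; +_)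
import Data.Integer.Divisibility.Signed as ℤ
import Data.Integer.Properties as ℤ
open import Data.Integer.Tactic.RingSolver using (solve-∀)
open import Data.List.Base
  using (List; []; _∷_; _++_; _ʳ++_; allFin; cartesianProduct; foldl; length; lookup; map; merge;
         zip)
import Data.List.Membership.DecPropositional as DecMembership
open import Data.List.Membership.Propositional using (_∈_; _∉_; find; lose)
open import Data.List.Membership.Propositional.Properties
  using (∈-allFin; ∈-filter⁺; ∈-filter⁻; ∈-++⁺ˡ; ∈-++⁺ʳ; ∈-++⁻; ∈-lookup)
open import Data.List.Membership.Propositional.Properties.WithK using (unique∧set⇒bag)
open import Data.List.NonEmpty.Base as List⁺ using (List⁺; _∷_; toList)
open import Data.List.Properties using (tabulate-lookup; ∷-injectiveʳ; map-∘; map-id)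
open import Data.List.Relation.Binary.BagAndSetEquality using (∼bag⇒↭)
open import Data.List.Relation.Binary.Disjoint.Propositional using (Disjoint)
open import Data.List.Relation.Binary.Permutation.Propositional using (_↭_; ↭-sym; ↭-trans; ↭⇒↭ₛ)
open import Data.List.Relation.Binary.Permutation.Propositional.Properties
  using (∈-resp-↭; drop-∷; merge-↭; ↭-empty-inv)
import Data.List.Relation.Binary.Permutation.Setoid.Properties as ↭ₛ
open import Data.List.Relation.Unary.All as All using (All; []; _∷_)
import Data.List.Relation.Unary.All.Properties as All
open import Data.List.Relation.Unary.AllPairs as AllPairs using (AllPairs; []; _∷_)
import Data.List.Relation.Unary.AllPairs.Properties as AllPairs
open import Data.List.Relation.Unary.Any as Any using (Any; here; there)
import Data.List.Relation.Unary.Any.Properties as Any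
open import Data.List.Relation.Unary.Linked as Linked using (Linked; []; [-]; _∷_)
open import Data.List.Relation.Unary.Linked.Properties using (AllPairs⇒Linked; Linked⇒AllPairs)
open import Data.List.Relation.Unary.Unique.Propositional using (Unique)
import Data.List.Relation.Unary.Unique.Propositional.Properties as Unique
open import Data.Maybe.Base using (just; nothing; maybe′)
open import Data.Nat.Base as ℕ using (ℕ; zero; suc; pred; _∸_; _≤_; z≤n; s≤s; ⌈_/2⌉)
import Data.Nat.Divisibility as ℕ
import Data.Nat.Properties as ℕ
open import Data.Product.Base using (∃; ∃-syntax; _×_; _,_; proj₁; proj₂)
open import Data.Sum.Base using (_⊎_; inj₁; inj₂; [_,_]′)
open import Function.Base using (flip; _∘_; case_of_)
open import Function.Bundles using (_⇔_; mk⇔; module Equivalence)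
open import Function.Definitions using (Injective)
open import Induction.WellFounded using (Acc; acc)
open import Level using (0ℓ)
open import Relation.Binary.Bundles using (StrictTotalOrder; DecTotalOrder)
open import Relation.Binary.Construct.Closure.ReflexiveTransitive using (Star; ε; _◅_; _◅◅_)
open import Relation.Binary.Construct.Closure.Symmetric using (SymClosure; fwd; bwd)
open import Relation.Binary.Core using (Rel)
open import Relation.Binary.Definitions using (tri<; tri≈; tri>)
open import Relation.Binary.PropositionalEquality
  using (_≡_; _≢_; refl; sym; trans; cong; subst; subst₂; setoid)
open import Relation.Nullary using (¬_; Dec; does; yes; no)
open import Relation.Nullary.Decidable using (dec-true; dec-false)

open Equivalence using (to; from)

-- Since arcs ascend in value, a surplus arc inside a chain can only skip forward. It changes
-- neither the smallest out-neighbour of a member nor the walk of the DFS. So `Decomposition`, the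
-- invariant of the rounds, tolerates such arcs: the arc from a root to its larger child becomes one
-- as soon as sub-trees are merged, and component merges create new ones. The DFS discards them, and
-- only the resulting `Exact` makes the graph a path rather than a supergraph of one. For this
-- reason the conclusion is drawn after at least one round, even if the forest is a single tree.
--
-- The pairs of a merge step are treated one after another on a growing graph, so a merged chain has
-- to survive the merges that follow. It does, because a merge adds arcs only among the vertices of
-- its own two chains.
--
-- Reach one enters through the bound of two neighbours: a vertex with a parent has spent one of
-- them, so a tree can branch at its root only. As some finite `i` is all that is asked for, it
-- suffices that each round loses a chain while two or more are left; no logarithmic bound is
-- derived.

module _ {x} {X : Set x} where

  lookup-injective : {xs : List X} → Unique xs → ∀ i j → lookup xs i ≡ lookup xs j → i ≡ j
  lookup-injective (x∉ ∷ u) zero    zero    eq = refl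
  lookup-injective (x∉ ∷ u) zero    (suc j) eq = ⊥-elim (All.lookup x∉ (∈-lookup j) eq)
  lookup-injective (x∉ ∷ u) (suc i) zero    eq = ⊥-elim (All.lookup x∉ (∈-lookup i) (sym eq))
  lookup-injective (x∉ ∷ u) (suc i) (suc j) eq = cong suc (lookup-injective u i j eq)

  Unique-resp-↭ : {xs ys : List X} → xs ↭ ys → Unique xs → Unique ys
  Unique-resp-↭ xs↭ys = ↭ₛ.Unique-resp-↭ (setoid X) (↭⇒↭ₛ xs↭ys)

  -- If the heads differ, each occurs in the tail of the other list, so `R` holds between them in
  -- both directions. Topological sorts are compared this way, with position as `R`.
  AllPairs-unique : ∀ {r} {R : Rel X r} → (∀ {u v} → R u v → ¬ R v u) →
                    ∀ {xs ys} → AllPairs R xs → AllPairs R ys → xs ↭ ys → xs ≡ ys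
  AllPairs-unique asym {[]}     {ys} _ _ p = sym (↭-empty-inv (↭-sym p))
  AllPairs-unique asym {_ ∷ _} {[]} _ _ p with () ← ↭-empty-inv p
  AllPairs-unique asym {x ∷ xs} {y ∷ ys} (x< ∷ xs<) (y< ∷ ys<) p
    with ∈-resp-↭ p (here refl) | ∈-resp-↭ (↭-sym p) (here refl)
  ... | here refl  | _          = cong (x ∷_) (AllPairs-unique asym xs< ys< (drop-∷ p))
  ... | there _    | here refl  = cong (x ∷_) (AllPairs-unique asym xs< ys< (drop-∷ p))
  ... | there x∈ys | there y∈xs = ⊥-elim (asym (All.lookup x< y∈xs) (All.lookup y< x∈ys))

  AllPairs-∈ : ∀ {r} {R : Rel X r} {xs} → AllPairs R xs → ∀ {u v} → u ∈ xs → v ∈ xs →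
               u ≡ v ⊎ R u v ⊎ R v u
  AllPairs-∈ (_  ∷ _)  (here refl) (here refl) = inj₁ refl
  AllPairs-∈ (r  ∷ _)  (here refl) (there v∈)  = inj₂ (inj₁ (All.lookup r v∈))
  AllPairs-∈ (r  ∷ _)  (there u∈)  (here refl) = inj₂ (inj₂ (All.lookup r u∈))
  AllPairs-∈ (_  ∷ rs) (there u∈)  (there v∈)  = AllPairs-∈ rs u∈ v∈

  Disjoint⇒∉ : ∀ {xs : List X} {cs} → All (λ c → Disjoint xs (toList c)) cs →
               ∀ {v} → v ∈ xs → ¬ Any (λ c → v ∈ toList c) cs
  Disjoint⇒∉ (d ∷ _)  v∈ (here v∈c)  = d (v∈ , v∈c)
  Disjoint⇒∉ (_ ∷ ds) v∈ (there v∈c) = Disjoint⇒∉ ds v∈ v∈c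

  ∉⇒Disjoint : ∀ {xs : List X} cs → (∀ {v} → v ∈ xs → ¬ Any (λ c → v ∈ toList c) cs) →
               All (λ c → Disjoint xs (toList c)) cs
  ∉⇒Disjoint []       _  = []
  ∉⇒Disjoint (c ∷ cs) v∉ =
    (λ (v∈ , v∈c) → v∉ v∈ (here v∈c)) ∷ ∉⇒Disjoint cs (λ v∈ → v∉ v∈ ∘ there)

∈-allFin⇒↭ : ∀ {n} {xs : List (Fin n)} → Unique xs → (∀ v → v ∈ xs) → xs ↭ allFin n
∈-allFin⇒↭ {n} u all∈ = ∼bag⇒↭ (unique∧set⇒bag u (Unique.allFin⁺ n)
  (λ {v} → mk⇔ (λ _ → ∈-allFin v) (λ _ → all∈ v)))

module _ {a ℓ₁ ℓ₂} (O : StrictTotalOrder a ℓ₁ ℓ₂) {n : ℕ} (A : Fin n → StrictTotalOrder.Carrier O)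
         (A-injective : Injective _≡_ (StrictTotalOrder._≈_ O) A) where

  open ArraySort O A
  open StrictTotalOrder byValue using ()
    renaming (irrefl to ≈⇒⊀; asym to ≺-asym; trans to ≺-trans; module Eq to ≈)
  open DecMembership (Fin._≟_ {n}) using (_∈?_)

  ≺-irrefl : ∀ {u} → ¬ u ≺ u
  ≺-irrefl = ≈⇒⊀ ≈.refl

  arc⇒≺ : ∀ G {u v} → Arc G u v → u ≺ v
  arc⇒≺ G = All.lookup (ascending G)

  Linked⇒≺ : ∀ {G xs} → Linked (Arc G) xs → AllPairs _≺_ xs
  Linked⇒≺ {G} = Linked⇒AllPairs ≺-trans ∘ Linked.map (arc⇒≺ G)

  -- Sorting determines the head only up to `≈`; injectivity of `A` turns a head with the value of
  -- `m` into `m` itself.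
  sortByValue-least : ∀ vs {m} → m ∈ vs → (∀ {v} → v ∈ vs → v ≡ m ⊎ m ≺ v) →
                      ∃ λ ws → sortByValue vs ≡ m ∷ ws
  sortByValue-least vs m∈ least with sortByValue vs | sortByValue-↭ vs | sortByValue-↗ vs
  ... | []     | p | _ with () ← ∈-resp-↭ (↭-sym p) m∈
  ... | w ∷ ws | p | s with ∈-resp-↭ (↭-sym p) m∈ | least (∈-resp-↭ p (here refl))
  ...   | here refl  | _         = ws , refl
  ...   | there _    | inj₁ refl = ws , refl
  ...   | there m∈ws | inj₂ m≺w
    with All.lookup (AllPairs.head (Linked⇒AllPairs (DecTotalOrder.trans byValue-decTotalOrder) s)) m∈ws
  ...     | inj₁ w≺m = ⊥-elim (≺-asym w≺m m≺w)
  ...     | inj₂ w≈m with refl ← A-injective w≈m = ws , refl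

  -- Smallest out-neighbours and the walks along them.

  module _ (G : ComparisonGraph) where

    ∈-outNeighbours⁻ : ∀ {u v} → v ∈ outNeighbours G u → Arc G u v
    ∈-outNeighbours⁻ {u} = proj₂ ∘ ∈-filter⁻ (arc? G u) {xs = allFin n} ∘ ∈-resp-↭ (sortByValue-↭ _)

    ∈-outNeighbours⁺ : ∀ {u v} → Arc G u v → v ∈ outNeighbours G u
    ∈-outNeighbours⁺ {u} {v} u→v =
      ∈-resp-↭ (↭-sym (sortByValue-↭ _)) (∈-filter⁺ (arc? G u) (∈-allFin v) u→v)

    outNeighbours-unique : ∀ u → Unique (outNeighbours G u)
    outNeighbours-unique u =
      Unique-resp-↭ (↭-sym (sortByValue-↭ _)) (Unique.filter⁺ (arc? G u) (Unique.allFin⁺ n))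

    outNeighbours-least : ∀ {u w} → Arc G u w → (∀ {v} → Arc G u v → v ≡ w ⊎ w ≺ v) →
                          ∃ λ ws → outNeighbours G u ≡ w ∷ ws
    outNeighbours-least {u} {w} u→w least = sortByValue-least _
      (∈-filter⁺ (arc? G u) (∈-allFin w) u→w)
      (least ∘ proj₂ ∘ ∈-filter⁻ (arc? G u) {xs = allFin n})

    smallestOutNeighbour-∷ : ∀ {u w ws} → outNeighbours G u ≡ w ∷ ws →
                             ∃ λ u≺w → smallestOutNeighbour G u ≡ just (w , u≺w)
    smallestOutNeighbour-∷ {u} eq with outNeighbours G u | outNeighbours-≻ G u
    smallestOutNeighbour-∷ refl | _ | u≺w ∷ _ = u≺w , refl

    smallestOutNeighbour-[] : ∀ {u} → outNeighbours G u ≡ [] → smallestOutNeighbour G u ≡ nothing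
    smallestOutNeighbour-[] {u} eq with outNeighbours G u | outNeighbours-≻ G u
    smallestOutNeighbour-[] refl | _ | _ = refl

    smallestOutNeighbour-arc : ∀ {u w u≺w} → smallestOutNeighbour G u ≡ just (w , u≺w) → Arc G u w
    smallestOutNeighbour-arc {u} eq
      with outNeighbours G u | outNeighbours-≻ G u | ∈-outNeighbours⁻ {u}
    smallestOutNeighbour-arc refl | _ ∷ _ | _ ∷ _ | arc = arc (here refl)

    -- The vertices that a merge pointer started at `u` would run through after `u`.
    descent : ∀ u → Acc (flip _≺_) u → List Vertex
    descent u (acc rs) =
      maybe′ (λ (w , u≺w) → w ∷ descent w (rs u≺w)) [] (smallestOutNeighbour G u)

    descent-linked : ∀ u ac → Linked (Arc G) (u ∷ descent u ac)
    descent-linked u (acc rs) with smallestOutNeighbour G u in eq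
    ... | nothing        = [-]
    ... | just (w , u≺w) = smallestOutNeighbour-arc eq ∷ descent-linked w (rs u≺w)

  -- The successors in G are merged by value: the arc added when p precedes q is
  -- needed if q precedes the successor of p; otherwise that successor comes next,
  -- and it is joined to p in G already.
  module _ (G : ComparisonGraph) where

    mergeLoop-⊆ : ∀ p q ap aq H {u v} → Arc H u v → Arc (mergeLoop G p q ap aq H) u v
    mergeLoop-⊆ p q ap@(acc rp) aq@(acc rq) H arc with compare p q
    ... | tri≈ _ _ _ = arc
    ... | tri< p≺q _ _ with smallestOutNeighbour G p
    ...   | nothing        = there arc
    ...   | just (w , p≺w) = mergeLoop-⊆ w q (rp p≺w) aq (addArc p≺q H) (there arc)
    mergeLoop-⊆ p q ap@(acc rp) aq@(acc rq) H arc | tri> _ _ q≺p with smallestOutNeighbour G q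
    ...   | nothing        = there arc
    ...   | just (w , q≺w) = mergeLoop-⊆ p w ap (rq q≺w) (addArc q≺p H) (there arc)

    -- Both pointers move along arcs of `G` and so keep every property closed under them. `P` is
    -- membership in the two chains for a component merge, and reachability from the root for the
    -- merging of sub-trees.
    mergeLoop-new : ∀ {P : Vertex → Set} → (∀ {x y} → Arc G x y → P x → P y) →
                    ∀ p q ap aq H → P p → P q → ∀ {u v} → Arc (mergeLoop G p q ap aq H) u v →
                    Arc H u v ⊎ (P u × P v)
    mergeLoop-new {P} closed p q ap@(acc rp) aq@(acc rq) H Pp Pq with compare p q
    ... | tri≈ _ _ _ = inj₁
    ... | tri< p≺q _ _ with smallestOutNeighbour G p in eq
    ...   | nothing        = λ { (here refl) → inj₂ (Pp , Pq) ; (there arc) → inj₁ arc }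
    ...   | just (w , p≺w) = λ arc →
      case mergeLoop-new closed w q (rp p≺w) aq (addArc p≺q H)
             (closed (smallestOutNeighbour-arc G eq) Pp) Pq arc of λ where
        (inj₁ (here refl)) → inj₂ (Pp , Pq)
        (inj₁ (there arc)) → inj₁ arc
        (inj₂ Puv)         → inj₂ Puv
    mergeLoop-new {P} closed p q ap@(acc rp) aq@(acc rq) H Pp Pq | tri> _ _ q≺p
      with smallestOutNeighbour G q in eq
    ...   | nothing        = λ { (here refl) → inj₂ (Pq , Pp) ; (there arc) → inj₁ arc }
    ...   | just (w , q≺w) = λ arc →
      case mergeLoop-new closed p w ap (rq q≺w) (addArc q≺p H)
             Pp (closed (smallestOutNeighbour-arc G eq) Pq) arc of λ where
        (inj₁ (here refl)) → inj₂ (Pq , Pp)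
        (inj₁ (there arc)) → inj₁ arc
        (inj₂ Puv)         → inj₂ Puv

    -- The head of the merge is `y` or `z`; being related to both spares deciding which.
    ∷-merge-linked : ∀ {R : Rel Vertex 0ℓ} {x} y ys z zs → R x y → R x z →
                     Linked R (merge _≺?_ (y ∷ ys) (z ∷ zs)) →
                     Linked R (x ∷ merge _≺?_ (y ∷ ys) (z ∷ zs))
    ∷-merge-linked y _ z _ Rxy Rxz l with does (y ≺? z)
    ... | true  = Rxy ∷ l
    ... | false = Rxz ∷ l

    -- `H` grows while both walks stay those of `G`, so the successor arcs have to be at hand in `H`
    -- throughout. Once a pointer runs out, the rest of the other walk is linked already.
    -- Disjointness excludes the case of equal values, in which the loop would stop early.
    mergeLoop-linked : ∀ p q ap aq H → (∀ {u v} → Arc G u v → Arc H u v) →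
      Disjoint (p ∷ descent G p ap) (q ∷ descent G q aq) →
      Linked (Arc (mergeLoop G p q ap aq H))
             (merge _≺?_ (p ∷ descent G p ap) (q ∷ descent G q aq))
    mergeLoop-linked p q ap@(acc rp) aq@(acc rq) H G⊆H disj with compare p q
    ... | tri≈ _ p≈q _ with refl ← A-injective p≈q = ⊥-elim (disj (here refl , here refl))
    ... | tri< p≺q _ _ with smallestOutNeighbour G p in eq
    ...   | nothing        = here refl ∷ Linked.map (there ∘ G⊆H) (descent-linked G q aq)
    ...   | just (w , p≺w) = ∷-merge-linked w (descent G w (rp p≺w)) q (descent G q aq)
      (mergeLoop-⊆ w q (rp p≺w) aq (addArc p≺q H) (there (G⊆H (smallestOutNeighbour-arc G eq))))
      (mergeLoop-⊆ w q (rp p≺w) aq (addArc p≺q H) (here refl))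
      (mergeLoop-linked w q (rp p≺w) aq (addArc p≺q H) (there ∘ G⊆H)
        (λ (v∈ , v∈′) → disj (there v∈ , v∈′)))
    mergeLoop-linked p q ap@(acc rp) aq@(acc rq) H G⊆H disj | tri> _ _ q≺p
      with smallestOutNeighbour G q in eq
    ...   | nothing        = here refl ∷ Linked.map (there ∘ G⊆H) (descent-linked G p ap)
    ...   | just (w , q≺w) = ∷-merge-linked p (descent G p ap) w (descent G w (rq q≺w))
      (mergeLoop-⊆ p w ap (rq q≺w) (addArc q≺p H) (here refl))
      (mergeLoop-⊆ p w ap (rq q≺w) (addArc q≺p H) (there (G⊆H (smallestOutNeighbour-arc G eq))))
      (mergeLoop-linked p w ap (rq q≺w) (addArc q≺p H) (there ∘ G⊆H)
        (λ (v∈ , v∈′) → disj (v∈ , there v∈′)))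

  -- Chains and the component merge of two of them.

  Closed : ComparisonGraph → List Vertex → Set
  Closed G c = ∀ {u v} → Arc G u v → u ∈ c → v ∈ c

  -- Order by value is not a field: arcs ascend, so `linked` implies it. Arcs between
  -- non-consecutive members are allowed.
  record IsChain (G : ComparisonGraph) (c : List Vertex) : Set where
    field
      linked    : Linked (Arc G) c
      forwards  : Closed G c
      backwards : ∀ {u v} → Arc G u v → v ∈ c → u ∈ c

  open IsChain

  Chains : ComparisonGraph → List (List⁺ Vertex) → Set
  Chains G = All (IsChain G ∘ toList)

  AllDisjoint : List (List⁺ Vertex) → Set
  AllDisjoint = AllPairs (λ c d → Disjoint (toList c) (toList d))

  infix 4 _∈ᶜ_

  _∈ᶜ_ : Vertex → List (List⁺ Vertex) → Set
  v ∈ᶜ cs = Any (λ c → v ∈ toList c) cs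

  module _ (G : ComparisonGraph) where

    linked-least : ∀ {u us v} → Linked (Arc G) (u ∷ us) → v ∈ u ∷ us → v ≡ u ⊎ u ≺ v
    linked-least l (here v≡u) = inj₁ v≡u
    linked-least l (there v∈) = inj₂ (All.lookup (AllPairs.head (Linked⇒≺ {G} l)) v∈)

    -- An arc from the tail back to `u` would descend in value.
    closed-tail : ∀ {u us} → Linked (Arc G) (u ∷ us) → Closed G (u ∷ us) → Closed G us
    closed-tail l closed x→y x∈ with closed x→y (there x∈)
    ... | there y∈  = y∈
    ... | here refl =
      ⊥-elim (≺-asym (arc⇒≺ G x→y) (All.lookup (AllPairs.head (Linked⇒≺ {G} l)) x∈))

    outNeighbours-next : ∀ {u w us} → Linked (Arc G) (u ∷ w ∷ us) → Closed G (u ∷ w ∷ us) →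
                         ∃ λ ws → outNeighbours G u ≡ w ∷ ws
    outNeighbours-next (u→w ∷ l) closed = outNeighbours-least G u→w λ u→v →
      case closed u→v (here refl) of λ where
        (here refl) → ⊥-elim (≺-irrefl (arc⇒≺ G u→v))
        (there v∈)  → linked-least l v∈

    outNeighbours-last : ∀ {u} → Closed G (u ∷ []) → outNeighbours G u ≡ []
    outNeighbours-last {u} closed with outNeighbours G u | ∈-outNeighbours⁻ G {u}
    ... | []    | _   = refl
    ... | v ∷ _ | arc with here refl ← closed (arc (here refl)) (here refl) =
      ⊥-elim (≺-irrefl (arc⇒≺ G (arc (here refl))))

    descent-chain : ∀ {u} us → Linked (Arc G) (u ∷ us) → Closed G (u ∷ us) →
                    ∀ ac → descent G u ac ≡ us
    descent-chain {u} []       l closed (acc rs)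
      rewrite smallestOutNeighbour-[] G {u} (outNeighbours-last closed) = refl
    descent-chain {u} (w ∷ us) l closed (acc rs)
      with u≺w , eq ← smallestOutNeighbour-∷ G (proj₂ (outNeighbours-next l closed))
      rewrite eq
      = cong (w ∷_) (descent-chain us (Linked.tail l) (closed-tail l closed) (rs u≺w))

    connected-closed : ∀ {c} → IsChain G c → ∀ {u v} → Connected G u v → u ∈ c → v ∈ c
    connected-closed ch ε              u∈ = u∈
    connected-closed ch (fwd u→w ◅ ss) u∈ = connected-closed ch ss (forwards ch u→w u∈)
    connected-closed ch (bwd w→u ◅ ss) u∈ = connected-closed ch ss (backwards ch w→u u∈)

    -- Connectivity follows arcs either way, so both closure conditions are used to confine the
    -- component of `r` to the chain.
    minimum-component : ∀ {r us} → IsChain G (r ∷ us) → minimum (component G r) ≡ just r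
    minimum-component {r} ch
      with _ , eq ← sortByValue-least (component G r)
             (∈-filter⁺ (connected? G r) (∈-allFin r) ε)
             (λ v∈ → linked-least (linked ch) (connected-closed ch
                (proj₂ (∈-filter⁻ (connected? G r) {xs = allFin n} v∈)) (here refl)))
      rewrite eq = refl

    module _ {r s us vs} (r-chain : IsChain G (r ∷ us)) (s-chain : IsChain G (s ∷ vs))
             (disj : Disjoint (r ∷ us) (s ∷ vs)) where

      private
        m = merge _≺?_ (r ∷ us) (s ∷ vs)
        H = mergeLoop G r s (≻-wellFounded r) (≻-wellFounded s) G

      componentMerge-mergeLoop : componentMerge G r s ≡ H
      componentMerge-mergeLoop
        rewrite minimum-component r-chain | minimum-component s-chain = refl

      ∈-merge⁺ : ∀ {v} → v ∈ r ∷ us ⊎ v ∈ s ∷ vs → v ∈ m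
      ∈-merge⁺ v∈ = ∈-resp-↭ (↭-sym (merge-↭ _≺?_ (r ∷ us) (s ∷ vs)))
        ([ ∈-++⁺ˡ , ∈-++⁺ʳ (r ∷ us) ]′ v∈)

      ∈-merge⁻ : ∀ {v} → v ∈ m → v ∈ r ∷ us ⊎ v ∈ s ∷ vs
      ∈-merge⁻ v∈ = ∈-++⁻ (r ∷ us) (∈-resp-↭ (merge-↭ _≺?_ (r ∷ us) (s ∷ vs)) v∈)

      private
        H-⊆ : ∀ {u v} → Arc G u v → Arc H u v
        H-⊆ = mergeLoop-⊆ G r s (≻-wellFounded r) (≻-wellFounded s) G

        H-new : ∀ {u v} → Arc H u v → Arc G u v ⊎ (u ∈ m × v ∈ m)
        H-new = mergeLoop-new G
          (λ x→y x∈ → ∈-merge⁺ ([ inj₁ ∘ forwards r-chain x→y , inj₂ ∘ forwards s-chain x→y ]′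
                                  (∈-merge⁻ x∈)))
          r s (≻-wellFounded r) (≻-wellFounded s) G
          (∈-merge⁺ (inj₁ (here refl))) (∈-merge⁺ (inj₂ (here refl)))

        m-linked : Linked (Arc H) m
        m-linked
          with l ← mergeLoop-linked G r s (≻-wellFounded r) (≻-wellFounded s) G (λ arc → arc)
          rewrite descent-chain us (linked r-chain) (forwards r-chain) (≻-wellFounded r)
                | descent-chain vs (linked s-chain) (forwards s-chain) (≻-wellFounded s)
          = l disj

      componentMerge-merges : IsChain (componentMerge G r s) m
      componentMerge-merges rewrite componentMerge-mergeLoop = record
        { linked    = m-linked
        ; forwards  = λ x→y x∈ → case H-new x→y of λ where
            (inj₁ x→y)       → ∈-merge⁺ ([ inj₁ ∘ forwards r-chain x→y ,
                                           inj₂ ∘ forwards s-chain x→y ]′ (∈-merge⁻ x∈))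
            (inj₂ (_ , y∈))  → y∈
        ; backwards = λ x→y y∈ → case H-new x→y of λ where
            (inj₁ x→y)       → ∈-merge⁺ ([ inj₁ ∘ backwards r-chain x→y ,
                                           inj₂ ∘ backwards s-chain x→y ]′ (∈-merge⁻ y∈))
            (inj₂ (x∈ , _))  → x∈
        }

      componentMerge-keeps : ∀ {e} → IsChain G e → Disjoint e (r ∷ us) → Disjoint e (s ∷ vs) →
                             IsChain (componentMerge G r s) e
      componentMerge-keeps {e} ch e#r e#s rewrite componentMerge-mergeLoop = record
        { linked    = Linked.map H-⊆ (linked ch)
        ; forwards  = λ x→y x∈ → case H-new x→y of λ where
            (inj₁ x→y)       → forwards ch x→y x∈
            (inj₂ (x∈′ , _)) → ⊥-elim (e#m x∈ x∈′)
        ; backwards = λ x→y y∈ → case H-new x→y of λ where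
            (inj₁ x→y)       → backwards ch x→y y∈
            (inj₂ (_ , y∈′)) → ⊥-elim (e#m y∈ y∈′)
        }
        where
        e#m : ∀ {v} → v ∈ e → ¬ v ∈ m
        e#m v∈ v∈m = [ (λ v∈′ → e#r (v∈ , v∈′)) , (λ v∈′ → e#s (v∈ , v∈′)) ]′ (∈-merge⁻ v∈m)

  -- The merge step on a list of chains.

  merge⁺ : List⁺ Vertex → List⁺ Vertex → List⁺ Vertex
  merge⁺ (r ∷ us) (s ∷ vs) =
    if does (r ≺? s) then r ∷ merge _≺?_ us (s ∷ vs) else s ∷ merge _≺?_ (r ∷ us) vs

  toList-merge⁺ : ∀ c d → toList (merge⁺ c d) ≡ merge _≺?_ (toList c) (toList d)
  toList-merge⁺ (r ∷ us) (s ∷ vs) with does (r ≺? s)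
  ... | true  = refl
  ... | false = refl

  -- `keeps` carries the induction: the pair in front is merged before the rest, and its chain has
  -- to survive the later merges. `members⁻` keeps that chain disjoint from the ones produced later.
  record Halving (G : ComparisonGraph) (cs : List (List⁺ Vertex))
                 (H : ComparisonGraph) (R : List Vertex) : Set where
    field
      chains   : List (List⁺ Vertex)
      isChains : Chains H chains
      disjoint : AllDisjoint chains
      heads    : R ≡ map List⁺.head chains
      size     : length chains ≡ ⌈ length cs /2⌉
      members⁺ : ∀ {v} → v ∈ᶜ cs → v ∈ᶜ chains
      members⁻ : ∀ {v} → v ∈ᶜ chains → v ∈ᶜ cs
      keeps    : ∀ {e} → IsChain G e → All (λ c → Disjoint e (toList c)) cs → IsChain H e

  mergeStep-halves : ∀ G cs → Chains G cs → AllDisjoint cs →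
    let H , R = mergeStep G (map List⁺.head cs) in Halving G cs H R
  mergeStep-halves G [] chs disj = record
    { chains = [] ; isChains = chs ; disjoint = disj ; heads = refl ; size = refl
    ; members⁺ = λ v∈ → v∈ ; members⁻ = λ v∈ → v∈ ; keeps = λ ch _ → ch }
  mergeStep-halves G (c ∷ []) chs disj = record
    { chains = c ∷ [] ; isChains = chs ; disjoint = disj ; heads = refl ; size = refl
    ; members⁺ = λ v∈ → v∈ ; members⁻ = λ v∈ → v∈ ; keeps = λ ch _ → ch }
  mergeStep-halves G (c@(r ∷ us) ∷ d@(s ∷ vs) ∷ cs) (c-chain ∷ d-chain ∷ chs)
                   ((c#d ∷ c#cs) ∷ d#cs ∷ disj)
    = combine (mergeStep-halves (componentMerge G r s) cs (keepAll chs c#cs d#cs) disj)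
    where
    keepAll : ∀ {cs} → Chains G cs → All (λ e → Disjoint (toList c) (toList e)) cs →
              All (λ e → Disjoint (toList d) (toList e)) cs → Chains (componentMerge G r s) cs
    keepAll []         []           []           = []
    keepAll (ch ∷ chs) (c#e ∷ c#cs) (d#e ∷ d#cs) =
      componentMerge-keeps G c-chain d-chain c#d ch
        (λ (v∈ , v∈′) → c#e (v∈′ , v∈)) (λ (v∈ , v∈′) → d#e (v∈′ , v∈))
      ∷ keepAll chs c#cs d#cs

    ∈-merge⁺⁺ : ∀ {v} → v ∈ toList c ⊎ v ∈ toList d → v ∈ toList (merge⁺ c d)
    ∈-merge⁺⁺ {v} v∈ = subst (v ∈_) (sym (toList-merge⁺ c d)) (∈-merge⁺ G c-chain d-chain c#d v∈)

    ∈-merge⁺⁻ : ∀ {v} → v ∈ toList (merge⁺ c d) → v ∈ toList c ⊎ v ∈ toList d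
    ∈-merge⁺⁻ {v} v∈ = ∈-merge⁻ G c-chain d-chain c#d (subst (v ∈_) (toList-merge⁺ c d) v∈)

    m#cs : ∀ {v} → v ∈ toList (merge⁺ c d) → ¬ v ∈ᶜ cs
    m#cs v∈ = [ Disjoint⇒∉ c#cs , Disjoint⇒∉ d#cs ]′ (∈-merge⁺⁻ v∈)

    combine : let H , R = mergeStep (componentMerge G r s) (map List⁺.head cs)
                  H′ , R′ = mergeStep G (r ∷ s ∷ map List⁺.head cs) in
              Halving (componentMerge G r s) cs H R → Halving G (c ∷ d ∷ cs) H′ R′
    combine ih = record
      { chains   = merge⁺ c d ∷ chains
      ; isChains = subst₂ IsChain (sym H′≡H) (sym (toList-merge⁺ c d)) m-chain
                   ∷ subst (λ H → Chains H chains) (sym H′≡H) isChains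
      ; disjoint = ∉⇒Disjoint chains (λ v∈ → m#cs v∈ ∘ members⁻) ∷ disjoint
      ; heads    = heads′
      ; size     = cong suc size
      ; members⁺ = λ where
          (here v∈c)          → here (∈-merge⁺⁺ (inj₁ v∈c))
          (there (here v∈d))  → here (∈-merge⁺⁺ (inj₂ v∈d))
          (there (there v∈))  → there (members⁺ v∈)
      ; members⁻ = λ where
          (here v∈m)  → [ here , there ∘ here ]′ (∈-merge⁺⁻ v∈m)
          (there v∈)  → there (there (members⁻ v∈))
      ; keeps    = λ { {e} ch (e#c ∷ e#d ∷ e#cs) → subst (λ H → IsChain H e) (sym H′≡H)
          (keeps (componentMerge-keeps G c-chain d-chain c#d ch e#c e#d) e#cs) }
      }
      where
      open Halving ih
      -- The comparison of the two roots affects only the root list.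
      H′≡H : proj₁ (mergeStep G (r ∷ s ∷ map List⁺.head cs)) ≡
             proj₁ (mergeStep (componentMerge G r s) (map List⁺.head cs))
      H′≡H with r ≺? s
      ... | yes _ = refl
      ... | no  _ = refl

      -- `merge⁺` branches on the same test as `mergeStep`, so its head is the root that is kept.
      heads′ : proj₂ (mergeStep G (r ∷ s ∷ map List⁺.head cs)) ≡
               List⁺.head (merge⁺ c d) ∷ map List⁺.head chains
      heads′ with r ≺? s
      ... | yes _ = cong (r ∷_) heads
      ... | no  _ = cong (s ∷_) heads

      m-chain : IsChain (proj₁ (mergeStep (componentMerge G r s) (map List⁺.head cs)))
                        (merge _≺?_ (toList c) (toList d))
      m-chain = keeps (componentMerge-merges G c-chain d-chain c#d)
        (∉⇒Disjoint cs λ {v} v∈ → m#cs (subst (v ∈_) (sym (toList-merge⁺ c d)) v∈))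

  -- Depth-first search along chains.

  Consecutive-∷ : ∀ {w ws u v} → Consecutive ws u v → Consecutive (w ∷ ws) u v
  Consecutive-∷ {w} (xs , ys , eq) = w ∷ xs , ys , cong (w ∷_) eq

  Consecutive-∈ : ∀ {ws u v} → Consecutive ws u v → u ∈ ws × v ∈ ws
  Consecutive-∈ (xs , ys , refl) = ∈-++⁺ʳ xs (here refl) , ∈-++⁺ʳ xs (there (here refl))

  Linked⇒Consecutive⊆ : ∀ {r} {R : Rel Vertex r} {ws} → Linked R ws →
                        ∀ {u v} → Consecutive ws u v → R u v
  Linked⇒Consecutive⊆ l ([]     , ys , refl) = Linked.head l
  Linked⇒Consecutive⊆ l (x ∷ xs , ys , refl) = Linked⇒Consecutive⊆ (Linked.tail l) (xs , ys , refl)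

  Consecutive-linked : ∀ ws → Linked (Consecutive ws) ws
  Consecutive-linked []           = []
  Consecutive-linked (w ∷ [])     = [-]
  Consecutive-linked (w ∷ x ∷ ws) =
    ([] , ws , refl) ∷ Linked.map Consecutive-∷ (Consecutive-linked (x ∷ ws))

  -- `zip (u ∷ us) us` lists the arcs in the order in which the DFS records them along the chain;
  -- `Consecutive` is how a Hamiltonian path is expressed.
  ∈-zip⇒Consecutive : ∀ {u} us {x y} → (x , y) ∈ zip (u ∷ us) us → Consecutive (u ∷ us) x y
  ∈-zip⇒Consecutive (w ∷ us) (here refl) = [] , us , refl
  ∈-zip⇒Consecutive (w ∷ us) (there xy∈) = Consecutive-∷ (∈-zip⇒Consecutive us xy∈)

  Consecutive⇒∈-zip : ∀ {u} us {x y} → Consecutive (u ∷ us) x y → (x , y) ∈ zip (u ∷ us) us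
  Consecutive⇒∈-zip us (xs , ys , eq) = go us xs eq
    where
    go : ∀ {u} us xs {x y ys} → u ∷ us ≡ xs ++ x ∷ y ∷ ys → (x , y) ∈ zip (u ∷ us) us
    go _        []       refl = here refl
    go []       (_ ∷ []) ()
    go []       (_ ∷ _ ∷ _) ()
    go (w ∷ us) (_ ∷ xs) eq   = there (go us xs (∷-injectiveʳ eq))

  module _ (G : ComparisonGraph) where

    explore-visited : ∀ u ac ws (u≺ws : All (u ≺_) ws) s → All (_∈ visited s) ws →
                      explore G u ac ws u≺ws s ≡ s
    explore-visited u ac       []       []           s []             = refl
    explore-visited u (acc rs) (w ∷ ws) (u≺w ∷ u≺ws) s (w∈ ∷ ws∈)
      rewrite dec-true (w ∈? visited s) w∈ = explore-visited u (acc rs) ws u≺ws s ws∈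

    -- The successor of u in the chain is visited first, and with it the rest of
    -- the chain, which contains all other out-neighbours of u.
    visit-chain : ∀ {u} us ac vis F → Linked (Arc G) (u ∷ us) → Closed G (u ∷ us) →
                  Disjoint (u ∷ us) vis →
                  let s = visit G u ac (state vis F) in
                  visited s ≡ (u ∷ us) ʳ++ vis ×
                  arcs (forest s) ≡ zip (u ∷ us) us ʳ++ arcs F
    visit-chain {u} [] (acc rs) vis F l closed disj
      with outNeighbours G u | outNeighbours-≻ G u | outNeighbours-last G closed
    ... | _ | [] | refl = refl , refl
    visit-chain {u} (w ∷ us) (acc rs) vis F l closed disj
      with outNeighbours G u | outNeighbours-≻ G u | ∈-outNeighbours⁻ G {u}
         | outNeighbours-next G l closed
    ... | _ | u≺w ∷ u≺ws | arc | ws , refl = explored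
      where
      w∉ : w ∉ u ∷ vis
      w∉ (here refl) = ≺-irrefl u≺w
      w∉ (there w∈)  = disj (there (here refl) , w∈)

      ih : let s = visit G w (rs u≺w) (state (u ∷ vis) (addArc u≺w F)) in
           visited s ≡ (w ∷ us) ʳ++ (u ∷ vis) ×
           arcs (forest s) ≡ zip (w ∷ us) us ʳ++ arcs (addArc u≺w F)
      ih = visit-chain us (rs u≺w) (u ∷ vis) (addArc u≺w F) (Linked.tail l)
             (closed-tail G l closed) λ where
        (v∈ , here refl)  → ≺-irrefl (All.lookup (AllPairs.head (Linked⇒≺ {G} l)) v∈)
        (v∈ , there v∈′)  → disj (there v∈ , v∈′)

      ws∈ : All (_∈ visited (visit G w (rs u≺w) (state (u ∷ vis) (addArc u≺w F)))) ws
      ws∈ = All.tabulate λ {v} v∈ → subst (v ∈_) (sym (proj₁ ih))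
        (Any.reverseAcc⁺ vis (u ∷ w ∷ us) (inj₂ (closed (arc (there v∈)) (here refl))))

      explored : let s = explore G u (acc rs) (w ∷ ws) (u≺w ∷ u≺ws) (state (u ∷ vis) F) in
                 visited s ≡ (w ∷ us) ʳ++ (u ∷ vis) ×
                 arcs (forest s) ≡ zip (w ∷ us) us ʳ++ arcs (addArc u≺w F)
      explored
        rewrite dec-false (w ∈? (u ∷ vis)) w∉
              | explore-visited u (acc rs) ws u≺ws
                  (visit G w (rs u≺w) (state (u ∷ vis) (addArc u≺w F))) ws∈
        = ih

    -- The starting state is arbitrary so that the induction can pass from chain to chain. A walk
    -- marks only its own chain, which leaves the heads of the others unvisited.
    visitAll-chains : ∀ cs vis F → Chains G cs → AllDisjoint cs →
      All (λ c → Disjoint (toList c) vis) cs →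
      ∀ {u v} → Arc (forest (visitAll G (map List⁺.head cs) (state vis F))) u v ⇔
                (Arc F u v ⊎ Any (λ c → Consecutive (toList c) u v) cs)
    visitAll-chains [] vis F _ _ _ = mk⇔ inj₁ λ { (inj₁ arc) → arc ; (inj₂ ()) }
    visitAll-chains ((r ∷ us) ∷ cs) vis F (ch ∷ chs) (c#cs ∷ disj) (c#vis ∷ cs#vis)
      rewrite dec-false (r ∈? vis) (λ r∈ → c#vis (here refl , r∈))
      with _ , arcs≡ ← visit-chain us (≻-wellFounded r) vis F (linked ch) (forwards ch) c#vis
      = mk⇔
          (λ arc → case to ih arc of λ where
            (inj₂ any)  → inj₂ (there any)
            (inj₁ arc′) → case Any.reverseAcc⁻ (arcs F) (zip (r ∷ us) us)
                                 (subst (_ ∈_) arcs≡ arc′) of λ where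
              (inj₁ arc)  → inj₁ arc
              (inj₂ xy∈)  → inj₂ (here (∈-zip⇒Consecutive us xy∈)))
          (λ where
            (inj₁ arc)         → from ih (inj₁ (subst (_ ∈_) (sym arcs≡)
                                   (Any.reverseAcc⁺ (arcs F) (zip (r ∷ us) us) (inj₁ arc))))
            (inj₂ (here con))  → from ih (inj₁ (subst (_ ∈_) (sym arcs≡)
                                   (Any.reverseAcc⁺ (arcs F) (zip (r ∷ us) us)
                                     (inj₂ (Consecutive⇒∈-zip us con)))))
            (inj₂ (there any)) → from ih (inj₂ any))
      where
      s = visit G r (≻-wellFounded r) (state vis F)

      unvisited : ∀ {e} → Disjoint (r ∷ us) e → Disjoint e vis → Disjoint e (visited s)
      unvisited c#e e#vis (v∈ , v∈s)
        with Any.reverseAcc⁻ vis (r ∷ us) (subst (_ ∈_)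
               (proj₁ (visit-chain us (≻-wellFounded r) vis F (linked ch) (forwards ch) c#vis)) v∈s)
      ... | inj₁ v∈vis = e#vis (v∈ , v∈vis)
      ... | inj₂ v∈c   = c#e (v∈c , v∈)

      ih : ∀ {u v} → Arc (forest (visitAll G (map List⁺.head cs) s)) u v ⇔
                     (Arc (forest s) u v ⊎ Any (λ c → Consecutive (toList c) u v) cs)
      ih = visitAll-chains cs (visited s) (forest s) chs disj
        (All.zipWith (λ (c#e , e#vis) {v} →
          unvisited (λ {v} → c#e {v}) (λ {v} → e#vis {v}) {v}) (c#cs , cs#vis))

    dfsForest-chains : ∀ cs → Chains G cs → AllDisjoint cs → ∀ {u v} →
      Arc (dfsForest G (map List⁺.head cs)) u v ⇔ Any (λ c → Consecutive (toList c) u v) cs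
    dfsForest-chains cs chs disj = mk⇔
      (λ arc → case to equiv arc of λ { (inj₂ any) → any })
      (λ any → from equiv (inj₂ any))
      where
      equiv : ∀ {u v} → _
      equiv {u} {v} = visitAll-chains cs [] emptyGraph chs disj (All.tabulate λ _ ()) {u} {v}

  -- The invariant of the rounds.

  record Decomposition (G : ComparisonGraph) (R : List Vertex) : Set where
    field
      chains   : List (List⁺ Vertex)
      isChains : Chains G chains
      disjoint : AllDisjoint chains
      heads    : R ≡ map List⁺.head chains
      covers   : ∀ v → v ∈ᶜ chains

  open Decomposition

  Exact : ∀ {G R} → Decomposition G R → Set
  Exact {G} D = ∀ {u v} → Arc G u v ⇔ Any (λ c → Consecutive (toList c) u v) (chains D)

  -- Every arc joins neighbours within some chain. If it touches `c`, disjointness identifies that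
  -- chain with `c`, so the arc neither enters nor leaves.
  exact⇒Chains : ∀ {G cs} → AllDisjoint cs →
    (∀ {u v} → Arc G u v ⇔ Any (λ c → Consecutive (toList c) u v) cs) → Chains G cs
  exact⇒Chains {G} {cs} disj exact = All.tabulate λ {c} c∈ → record
    { linked    = Linked.map (λ con → from exact (lose c∈ con)) (Consecutive-linked (toList c))
    ; forwards  = λ x→y x∈ → case find (to exact x→y) of λ where
        (d , d∈ , con) → subst (λ c → _ ∈ toList c)
          (same d∈ c∈ (proj₁ (Consecutive-∈ con)) x∈) (proj₂ (Consecutive-∈ con))
    ; backwards = λ x→y y∈ → case find (to exact x→y) of λ where
        (d , d∈ , con) → subst (λ c → _ ∈ toList c)
          (same d∈ c∈ (proj₂ (Consecutive-∈ con)) y∈) (proj₁ (Consecutive-∈ con))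
    }
    where
    same : ∀ {c d} → c ∈ cs → d ∈ cs → ∀ {v} → v ∈ toList c → v ∈ toList d → c ≡ d
    same c∈ d∈ v∈c v∈d = case AllPairs-∈ disj c∈ d∈ of λ where
      (inj₁ eq)         → eq
      (inj₂ (inj₁ c#d)) → ⊥-elim (c#d (v∈c , v∈d))
      (inj₂ (inj₂ d#c)) → ⊥-elim (d#c (v∈d , v∈c))

  round-decomposes : ∀ {G R} (D : Decomposition G R) →
    let G′ , R′ = round (G , R) in
    ∃ λ (D′ : Decomposition G′ R′) → Exact D′ × length (chains D′) ≡ ⌈ length (chains D) /2⌉
  round-decomposes {G} record
    { chains = ds ; isChains = chs ; disjoint = disj ; heads = refl ; covers = covers }
    with mergeStep G (map List⁺.head ds) | mergeStep-halves G ds chs disj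
  ... | H , _ | record { chains = cs ; isChains = chs′ ; disjoint = disj′ ; heads = refl
                       ; size = size ; members⁺ = members⁺ } = record
    { chains   = cs
    ; isChains = exact⇒Chains disj′ (λ {u} {v} → exact {u} {v})
    ; disjoint = disj′
    ; heads    = refl
    ; covers   = members⁺ ∘ covers
    } , (λ {u} {v} → exact {u} {v}) , size
    where
    exact : ∀ {u v} → Arc (dfsForest H (map List⁺.head cs)) u v ⇔
                      Any (λ c → Consecutive (toList c) u v) cs
    exact = dfsForest-chains H cs chs′ disj′

  -- Halving loses at least one chain as long as two are left, and truncated subtraction makes the
  -- bound stop at one. The index is `suc i` because exactness comes from the DFS that ends a round.
  rounds-decompose : ∀ {G R} (D : Decomposition G R) k → length (chains D) ≤ suc k →
    ∀ i → ∃ λ (D′ : Decomposition (proj₁ (rounds G R (suc i))) (proj₂ (rounds G R (suc i)))) →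
          Exact D′ × length (chains D′) ≤ suc (k ∸ suc i)
  rounds-decompose {G} {R} D k ≤k i = let D′ , exact , size = round-decomposes (proj₁ (before i)) in
    D′ , (λ {u} {v} → exact {u} {v}) , ℕ.≤-trans (ℕ.≤-reflexive size) (shrinks i (proj₂ (before i)))
    where
    half : ∀ m → ⌈ suc m /2⌉ ≤ suc (pred m)
    half zero    = s≤s z≤n
    half (suc m) = s≤s (ℕ.⌈n/2⌉≤n m)

    shrinks : ∀ i {m} → m ≤ suc (k ∸ i) → ⌈ m /2⌉ ≤ suc (k ∸ suc i)
    shrinks i m≤ = ℕ.≤-trans (ℕ.⌈n/2⌉-mono m≤)
      (subst (λ j → ⌈ suc (k ∸ i) /2⌉ ≤ suc j) (ℕ.pred[m∸n]≡m∸[1+n] k i) (half (k ∸ i)))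

    before : ∀ i → ∃ λ (D : Decomposition (proj₁ (rounds G R i)) (proj₂ (rounds G R i))) →
                   length (chains D) ≤ suc (k ∸ i)
    before zero    = D , ≤k
    before (suc i) = let D , ≤k∸i = before i ; D′ , _ , size = round-decomposes D in
      D′ , ℕ.≤-trans (ℕ.≤-reflexive size) (shrinks i ≤k∸i)

  -- Merging the sub-trees of the forest.

  module SubtreeMerging (F : ComparisonGraph)
    (parent-unique : ∀ {u v w} → Arc F u w → Arc F v w → u ≡ v)
    (degree≤2 : ∀ {u x y z} → SymClosure (Arc F) u x → SymClosure (Arc F) u y →
                SymClosure (Arc F) u z → x ≡ y ⊎ y ≡ z ⊎ x ≡ z)
    where

    infix 4 _⟶*_

    _⟶*_ : Rel Vertex 0ℓ
    _⟶*_ = Star (Arc F)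

    ⟶*⇒≼ : ∀ {u v} → u ⟶* v → v ≡ u ⊎ u ≺ v
    ⟶*⇒≼ ε           = inj₁ refl
    ⟶*⇒≼ (u→w ◅ w⟶v) with ⟶*⇒≼ w⟶v
    ... | inj₁ refl = inj₂ (arc⇒≺ F u→w)
    ... | inj₂ w≺v  = inj₂ (≺-trans (arc⇒≺ F u→w) w≺v)

    -- The last arc of a non-trivial path into `w` can only start at the single parent of `w`.
    ⟶*-parent : ∀ {u v w} → Arc F v w → u ⟶* w → u ≡ w ⊎ u ⟶* v
    ⟶*-parent v→w ε            = inj₁ refl
    ⟶*-parent v→w (u→x ◅ x⟶*w) with ⟶*-parent v→w x⟶*w
    ... | inj₁ refl  = inj₂ (subst (_ ⟶*_) (parent-unique u→x v→w) ε)
    ... | inj₂ x⟶*v  = inj₂ (u→x ◅ x⟶*v)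

    -- With unique parents, two paths followed back from `w` agree for as long as both last.
    ancestors-comparable : ∀ {u v w} → u ⟶* w → v ⟶* w → u ⟶* v ⊎ v ⟶* u
    ancestors-comparable ε            v⟶*w = inj₂ v⟶*w
    ancestors-comparable (u→x ◅ x⟶*w) v⟶*w with ancestors-comparable x⟶*w v⟶*w
    ... | inj₁ x⟶*v = inj₁ (u→x ◅ x⟶*v)
    ... | inj₂ v⟶*x with ⟶*-parent u→x v⟶*x
    ...   | inj₁ refl = inj₁ (u→x ◅ ε)
    ...   | inj₂ v⟶*u = inj₂ v⟶*u

    ⟶*-root : ∀ {u r} → Root F r → u ⟶* r → u ≡ r
    ⟶*-root root ε            = refl
    ⟶*-root root (u→x ◅ x⟶*r) with refl ← ⟶*-root root x⟶*r = ⊥-elim (root _ u→x)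

    root-unique : ∀ {r s v} → Root F r → Root F s → r ⟶* v → s ⟶* v → r ≡ s
    root-unique r-root s-root r⟶*v s⟶*v with ancestors-comparable r⟶*v s⟶*v
    ... | inj₁ r⟶*s = ⟶*-root s-root r⟶*s
    ... | inj₂ s⟶*r = sym (⟶*-root r-root s⟶*r)

    -- Climbing to parents lowers the value, so it ends.
    has-root : ∀ v → ∃ λ r → Root F r × r ⟶* v
    has-root v = go v (Fin.spo-wellFounded (StrictTotalOrder.isStrictPartialOrder byValue) v)
      where
      go : ∀ v → Acc _≺_ v → ∃ λ r → Root F r × r ⟶* v
      go v (acc rs) with Fin.any? (λ u → arc? F u v)
      ... | no ∄u          = v , (λ u u→v → ∄u (u , u→v)) , ε
      ... | yes (u , u→v) with r , root , r⟶*u ← go u (rs (arc⇒≺ F u→v)) =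
        r , root , r⟶*u ◅◅ (u→v ◅ ε)

    -- The parent is one of at most two neighbours of `u`, and since arcs ascend it cannot also be a
    -- child.
    child-unique : ∀ {p u x y} → Arc F p u → Arc F u x → Arc F u y → x ≡ y
    child-unique p→u u→x u→y with degree≤2 (bwd p→u) (fwd u→x) (fwd u→y)
    ... | inj₁ refl        = ⊥-elim (≺-asym (arc⇒≺ F p→u) (arc⇒≺ F u→x))
    ... | inj₂ (inj₁ x≡y)  = x≡y
    ... | inj₂ (inj₂ refl) = ⊥-elim (≺-asym (arc⇒≺ F p→u) (arc⇒≺ F u→y))

    -- A common descendant would make one child an ancestor of the other, hence equal to `r` or an
    -- ancestor of it, although arcs from `r` ascend.
    children-disjoint : ∀ {r a b v} → Arc F r a → Arc F r b → a ≢ b → a ⟶* v → ¬ b ⟶* v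
    children-disjoint {r} r→a r→b a≢b a⟶*v b⟶*v =
      [ incomparable r→a r→b a≢b , incomparable r→b r→a (a≢b ∘ sym) ]′
        (ancestors-comparable a⟶*v b⟶*v)
      where
      incomparable : ∀ {a b} → Arc F r a → Arc F r b → a ≢ b → ¬ a ⟶* b
      incomparable r→a r→b a≢b a⟶*b with ⟶*-parent r→b a⟶*b
      ... | inj₁ a≡b  = a≢b a≡b
      ... | inj₂ a⟶*r with ⟶*⇒≼ a⟶*r
      ...   | inj₁ refl = ≺-irrefl (arc⇒≺ F r→a)
      ...   | inj₂ a≺r  = ≺-asym a≺r (arc⇒≺ F r→a)

    branch : Vertex → List Vertex
    branch u = u ∷ descent F u (≻-wellFounded u)

    ∈-branch⁻ : ∀ {u v} → v ∈ branch u → u ⟶* v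
    ∈-branch⁻ {u} = reach (descent-linked F u (≻-wellFounded u))
      where
      reach : ∀ {u us v} → Linked (Arc F) (u ∷ us) → v ∈ u ∷ us → u ⟶* v
      reach l         (here refl) = ε
      reach (u→w ∷ l) (there v∈)  = u→w ◅ reach l v∈

    -- The arc into `u` leaves room for one child only, and the same holds at every vertex below, so
    -- the walk along smallest children misses no descendant.
    ∈-branch⁺ : ∀ {p u v} → Arc F p u → u ⟶* v → v ∈ branch u
    ∈-branch⁺ {u = u} p→u u⟶*v = go (≻-wellFounded u) p→u u⟶*v
      where
      go : ∀ {p u v} ac → Arc F p u → u ⟶* v → v ∈ u ∷ descent F u ac
      go ac       p→u ε            = here refl
      go (acc rs) p→u (u→w ◅ w⟶*v)
        with u≺w , eq ← smallestOutNeighbour-∷ F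
               (proj₂ (outNeighbours-least F u→w (λ u→v → inj₁ (child-unique p→u u→v u→w))))
        rewrite eq = there (go (rs u≺w) u→w w⟶*v)

    mergeBranches : List Vertex → List Vertex
    mergeBranches []          = []
    mergeBranches (a ∷ [])    = branch a
    mergeBranches (a ∷ b ∷ _) = merge _≺?_ (branch a) (branch b)

    treeChain : Vertex → List⁺ Vertex
    treeChain r = r ∷ mergeBranches (outNeighbours F r)

    data Children (r : Vertex) : List Vertex → Set where
      none : (∀ {v} → ¬ Arc F r v) → Children r []
      one  : ∀ {a} → Arc F r a → (∀ {v} → Arc F r v → v ≡ a) → Children r (a ∷ [])
      two  : ∀ {a b} → Arc F r a → Arc F r b → a ≢ b → (∀ {v} → Arc F r v → v ≡ a ⊎ v ≡ b) →
             Children r (a ∷ b ∷ [])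

    children : ∀ r → Children r (outNeighbours F r)
    children r with outNeighbours F r | ∈-outNeighbours⁻ F {r} | ∈-outNeighbours⁺ F {r}
                  | outNeighbours-unique F r
    ... | []             | _   | mem | _ = none λ arc → case mem arc of λ ()
    ... | a ∷ []         | arc | mem | _ = one (arc (here refl)) λ r→v → case mem r→v of λ where
      (here v≡a) → v≡a
    ... | a ∷ b ∷ []     | arc | mem | (a≢b ∷ _) ∷ _ =
      two (arc (here refl)) (arc (there (here refl))) a≢b λ r→v → case mem r→v of λ where
        (here v≡a)         → inj₁ v≡a
        (there (here v≡b)) → inj₂ v≡b
    ... | a ∷ b ∷ c ∷ _  | arc | _ | (a≢b ∷ a≢c ∷ _) ∷ (b≢c ∷ _) ∷ _
      with degree≤2 (fwd (arc (here refl))) (fwd (arc (there (here refl))))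
                    (fwd (arc (there (there (here refl)))))
    ...   | inj₁ a≡b        = ⊥-elim (a≢b a≡b)
    ...   | inj₂ (inj₁ b≡c) = ⊥-elim (b≢c b≡c)
    ...   | inj₂ (inj₂ a≡c) = ⊥-elim (a≢c a≡c)

    ∈-treeChain⁻ : ∀ {r v} → v ∈ toList (treeChain r) → r ⟶* v
    ∈-treeChain⁻         (here refl) = ε
    ∈-treeChain⁻ {r} {v} (there v∈)  = go (children r) v∈
      where
      go : ∀ {ws} → Children r ws → v ∈ mergeBranches ws → r ⟶* v
      go (one r→a _)               v∈ = r→a ◅ ∈-branch⁻ v∈
      go (two {a} {b} r→a r→b _ _) v∈ =
        [ (λ v∈ → r→a ◅ ∈-branch⁻ v∈) , (λ v∈ → r→b ◅ ∈-branch⁻ v∈) ]′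
          (∈-++⁻ (branch a) (∈-resp-↭ (merge-↭ _≺?_ (branch a) (branch b)) v∈))

    ∈-treeChain⁺ : ∀ {r v} → r ⟶* v → v ∈ toList (treeChain r)
    ∈-treeChain⁺         ε                = here refl
    ∈-treeChain⁺ {r} {v} (r→w ◅ w⟶*v) = there (go (children r))
      where
      go : ∀ {ws} → Children r ws → v ∈ mergeBranches ws
      go (none ∄)                     = ⊥-elim (∄ r→w)
      go (one r→a only) with refl ← only r→w = ∈-branch⁺ r→w w⟶*v
      go (two {a} {b} r→a r→b _ only) = ∈-resp-↭ (↭-sym (merge-↭ _≺?_ (branch a) (branch b)))
        (case only r→w of λ where
          (inj₁ refl) → ∈-++⁺ˡ (∈-branch⁺ r→w w⟶*v)
          (inj₂ refl) → ∈-++⁺ʳ (branch a) (∈-branch⁺ r→w w⟶*v))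

    mergeChildren-⊆ : ∀ H r {u v} → Arc H u v → Arc (mergeChildren F H r) u v
    mergeChildren-⊆ H r arc with outNeighbours F r
    ... | []            = arc
    ... | a ∷ []        = arc
    ... | a ∷ b ∷ []    = mergeLoop-⊆ F a b (≻-wellFounded a) (≻-wellFounded b) H arc
    ... | _ ∷ _ ∷ _ ∷ _ = arc

    mergeChildren-new : ∀ H r {u v} → Arc (mergeChildren F H r) u v →
                        Arc H u v ⊎ (r ⟶* u × r ⟶* v)
    mergeChildren-new H r with outNeighbours F r | ∈-outNeighbours⁻ F {r}
    ... | []            | _   = inj₁
    ... | a ∷ []        | _   = inj₁
    ... | a ∷ b ∷ []    | arc = mergeLoop-new F (λ x→y r⟶*x → r⟶*x ◅◅ (x→y ◅ ε))
      a b (≻-wellFounded a) (≻-wellFounded b) H (arc (here refl) ◅ ε) (arc (there (here refl)) ◅ ε)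
    ... | _ ∷ _ ∷ _ ∷ _ | _   = inj₁

    mergeChildren-linked : ∀ H r → (∀ {u v} → Arc F u v → Arc H u v) →
                           Linked (Arc (mergeChildren F H r)) (toList (treeChain r))
    mergeChildren-linked H r F⊆H with outNeighbours F r | children r
    ... | _ | none _    = [-]
    ... | _ | one {a} r→a _ = F⊆H r→a ∷ Linked.map F⊆H (descent-linked F a (≻-wellFounded a))
    -- Both children are joined to `r` in `F`, so whichever comes first in the merge continues the
    -- chain.
    ... | _ | two {a} {b} r→a r→b a≢b _ = ∷-merge-linked F
      a (descent F a (≻-wellFounded a)) b (descent F b (≻-wellFounded b))
      (mergeLoop-⊆ F a b (≻-wellFounded a) (≻-wellFounded b) H (F⊆H r→a))
      (mergeLoop-⊆ F a b (≻-wellFounded a) (≻-wellFounded b) H (F⊆H r→b))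
      (mergeLoop-linked F a b (≻-wellFounded a) (≻-wellFounded b) H F⊆H
        λ (v∈a , v∈b) → children-disjoint r→a r→b a≢b (∈-branch⁻ v∈a) (∈-branch⁻ v∈b))

    mergeAll : ComparisonGraph → List Vertex → ComparisonGraph
    mergeAll = foldl (mergeChildren F)

    mergeAll-⊆ : ∀ H rs {u v} → Arc H u v → Arc (mergeAll H rs) u v
    mergeAll-⊆ H []       arc = arc
    mergeAll-⊆ H (r ∷ rs) arc = mergeAll-⊆ (mergeChildren F H r) rs (mergeChildren-⊆ H r arc)

    mergeAll-new : ∀ H rs {u v} → Arc (mergeAll H rs) u v →
                   Arc H u v ⊎ ∃ λ r → r ∈ rs × r ⟶* u × r ⟶* v
    mergeAll-new H []       arc = inj₁ arc
    mergeAll-new H (r ∷ rs) arc with mergeAll-new (mergeChildren F H r) rs arc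
    ... | inj₂ (s , s∈ , su , sv) = inj₂ (s , there s∈ , su , sv)
    ... | inj₁ arc′ with mergeChildren-new H r arc′
    ...   | inj₁ arc″      = inj₁ arc″
    ...   | inj₂ (ru , rv) = inj₂ (r , here refl , ru , rv)

    mergeAll-linked : ∀ H rs {r} → (∀ {u v} → Arc F u v → Arc H u v) → r ∈ rs →
                      Linked (Arc (mergeAll H rs)) (toList (treeChain r))
    mergeAll-linked H (r ∷ rs) F⊆H (here refl) =
      Linked.map (mergeAll-⊆ (mergeChildren F H r) rs) (mergeChildren-linked H r F⊆H)
    mergeAll-linked H (r ∷ rs) F⊆H (there s∈)  =
      mergeAll-linked (mergeChildren F H r) rs (mergeChildren-⊆ H r ∘ F⊆H) s∈

    ∈-roots⁻ : ∀ {r} → r ∈ roots F → Root F r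
    ∈-roots⁻ = proj₂ ∘ ∈-filter⁻ (root? F) {xs = allFin n}

    -- Arcs of `F` stay within a tree, and an added arc has both ends in the tree of some root `s`.
    -- If that tree meets the one of `r`, uniqueness of roots gives `s ≡ r`.
    treeChain-isChain : ∀ {r} → r ∈ roots F → IsChain (mergeSubtrees F) (toList (treeChain r))
    treeChain-isChain {r} r∈ = record
      { linked    = mergeAll-linked F (roots F) (λ arc → arc) r∈
      ; forwards  = λ x→y x∈ → ∈-treeChain⁺ (case mergeAll-new F (roots F) x→y of λ where
          (inj₁ x→y)                → ∈-treeChain⁻ x∈ ◅◅ (x→y ◅ ε)
          (inj₂ (s , s∈ , sx , sy)) → subst (_⟶* _)
            (root-unique (∈-roots⁻ s∈) root sx (∈-treeChain⁻ x∈)) sy)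
      ; backwards = λ x→y y∈ → ∈-treeChain⁺ (case mergeAll-new F (roots F) x→y of λ where
          (inj₁ x→y)                → case ⟶*-parent x→y (∈-treeChain⁻ y∈) of λ where
            (inj₁ refl)  → ⊥-elim (root _ x→y)
            (inj₂ r⟶*x)  → r⟶*x
          (inj₂ (s , s∈ , sx , sy)) → subst (_⟶* _)
            (root-unique (∈-roots⁻ s∈) root sy (∈-treeChain⁻ y∈)) sx)
      }
      where
      root = ∈-roots⁻ r∈

    treeChain-disjoint : ∀ {r s} → Root F r → Root F s → r ≢ s →
                         Disjoint (toList (treeChain r)) (toList (treeChain s))
    treeChain-disjoint r-root s-root r≢s (v∈r , v∈s) =
      r≢s (root-unique r-root s-root (∈-treeChain⁻ v∈r) (∈-treeChain⁻ v∈s))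

    treeChains-disjoint : ∀ {R} → All (Root F) R → Unique R → AllDisjoint (map treeChain R)
    treeChains-disjoint []             []          = []
    treeChains-disjoint (root ∷ roots) (r≢ ∷ uniq) =
      All.map⁺ (All.zipWith (λ (s-root , r≢s) {v} →
        treeChain-disjoint root s-root r≢s {v}) (roots , r≢))
      ∷ treeChains-disjoint roots uniq

    mergeSubtrees-decomposes : ∀ {R} → R ↭ roots F → Decomposition (mergeSubtrees F) R
    mergeSubtrees-decomposes {R} R↭ = record
      { chains   = map treeChain R
      ; isChains = All.map⁺ (All.tabulate (treeChain-isChain ∘ ∈-resp-↭ R↭))
      ; disjoint = treeChains-disjoint (All.tabulate (∈-roots⁻ ∘ ∈-resp-↭ R↭))
          (Unique-resp-↭ (↭-sym R↭) (Unique.filter⁺ (root? F) (Unique.allFin⁺ n)))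
      ; heads    = trans (sym (map-id R)) (map-∘ R)
      ; covers   = λ v → let r , root , r⟶*v = has-root v in
          Any.map⁺ (lose (∈-resp-↭ (↭-sym R↭) (∈-filter⁺ (root? F) (∈-allFin r) root))
                         (∈-treeChain⁺ r⟶*v))
      }

  -- DFS gives every vertex at most one parent.

  module _ (G : ComparisonGraph) where

    -- Targets of forest arcs are marked, so a vertex found unvisited has no parent yet.
    record IsForest (s : DFSState) : Set where
      field
        ⊆G            : ∀ {u v} → Arc (forest s) u v → Arc G u v
        target        : ∀ {u v} → Arc (forest s) u v → v ∈ visited s
        parent-unique : ∀ {u v w} → Arc (forest s) u w → Arc (forest s) v w → u ≡ v

    open IsForest

    -- The invariant is assumed with `u` already marked: the arc into `u` is recorded just before
    -- the call, when `target` does not hold for it yet.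
    visit-isForest   : ∀ u ac vis F → IsForest (state (u ∷ vis) F) →
                       IsForest (visit G u ac (state vis F))
    explore-isForest : ∀ u ac ws (u≺ws : All (u ≺_) ws) → All (Arc G u) ws → ∀ s →
                       IsForest s → IsForest (explore G u ac ws u≺ws s)

    visit-isForest u ac vis F f = explore-isForest u ac (outNeighbours G u) (outNeighbours-≻ G u)
      (All.tabulate (∈-outNeighbours⁻ G)) (state (u ∷ vis) F) f

    explore-isForest u ac          []       []           []           s f = f
    explore-isForest u ac@(acc rs) (w ∷ ws) (u≺w ∷ u≺ws) (u→w ∷ u→ws) s f =
      explore-isForest u ac ws u≺ws u→ws _ (step (w ∈? visited s))
      where
      step : (w∈? : Dec (w ∈ visited s)) → IsForest (if does w∈? then s else
               visit G w (rs u≺w) (state (visited s) (addArc u≺w (forest s))))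
      step (yes _) = f
      step (no w∉) = visit-isForest w (rs u≺w) (visited s) (addArc u≺w (forest s)) record
        { ⊆G            = λ { (here refl) → u→w ; (there arc) → ⊆G f arc }
        ; target        = λ { (here refl) → here refl ; (there arc) → there (target f arc) }
        ; parent-unique = λ where
            (here refl) (here refl)  → refl
            (here refl) (there arc)  → ⊥-elim (w∉ (target f arc))
            (there arc) (here refl)  → ⊥-elim (w∉ (target f arc))
            (there arc) (there arc′) → parent-unique f arc arc′
        }

    visitAll-isForest : ∀ ls s → IsForest s → IsForest (visitAll G ls s)
    visitAll-isForest []       s f = f
    visitAll-isForest (l ∷ ls) s f with l ∈? visited s
    ... | yes _ = visitAll-isForest ls s f
    ... | no  _ = visitAll-isForest ls _ (visit-isForest l (≻-wellFounded l) (visited s) (forest s)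
      record { ⊆G = ⊆G f ; target = there ∘ target f ; parent-unique = parent-unique f })

    dfsForest-isForest : ∀ ls → IsForest (visitAll G ls (state [] emptyGraph))
    dfsForest-isForest ls = visitAll-isForest ls (state [] emptyGraph)
      record { ⊆G = λ () ; target = λ () ; parent-unique = λ () }

  -- Topological sorts of a path.

  Before-pairs : ∀ τ → AllPairs (Before τ) τ
  Before-pairs τ = subst (AllPairs (Before τ)) (tabulate-lookup τ)
    (AllPairs.tabulate⁺-< {f = lookup τ} λ {i} {j} i<j → i , j , i<j , refl , refl)

  module _ {τ : List Vertex} (τ-unique : Unique τ) where

    -- Without repetitions in `τ` the two occurrences of `v` are at the same position.
    Before-trans : ∀ {u v w} → Before τ u v → Before τ v w → Before τ u w
    Before-trans (i , j , i<j , refl , refl) (k , l , k<l , eq , refl)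
      with refl ← lookup-injective τ-unique k j eq = i , l , ℕ.<-trans i<j k<l , refl , refl

    Before-asym : ∀ {u v} → Before τ u v → ¬ Before τ v u
    Before-asym u<v v<u with i , j , i<j , refl , eq ← Before-trans u<v v<u
      with refl ← lookup-injective τ-unique j i eq = ℕ.<-irrefl refl i<j

  module _ {G : ComparisonGraph} {π : List Vertex} (covers : ∀ v → v ∈ π)
           (exact : ∀ u v → Arc G u v ⇔ Consecutive π u v) where

    private
      π-linked : Linked (Arc G) π
      π-linked = Linked.map (from (exact _ _)) (Consecutive-linked π)

      π-unique : Unique π
      π-unique = AllPairs.map (λ { u≺u refl → ≺-irrefl u≺u }) (Linked⇒≺ {G} π-linked)

    path-ordering : IsOrdering π
    path-ordering = ∈-allFin⇒↭ π-unique covers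

    path-sorted : IsSortedIndices π
    path-sorted = path-ordering , Linked.map (arc⇒≺ G) π-linked

    -- Any topological sort τ orders consecutive vertices of π as π does, hence all
    -- vertices, by transitivity of the order of positions in τ.
    path-topologicalSort : IsTheTopologicalSort G π
    path-topologicalSort =
      (path-ordering , λ u v u→v →
        Linked⇒Consecutive⊆ (AllPairs⇒Linked (Before-pairs π)) (to (exact u v) u→v)) ,
      λ τ (τ-ordering , topological) →
        let τ-unique = Unique-resp-↭ (↭-sym τ-ordering) (Unique.allFin⁺ n) in
        AllPairs-unique (Before-asym τ-unique) (Before-pairs τ)
          (Linked⇒AllPairs (Before-trans τ-unique) (Linked.map (topological _ _) π-linked))
          (↭-trans τ-ordering (↭-sym path-ordering))

  exact⇒path : ∀ {G R} (D : Decomposition G R) → Exact D → length (chains D) ≤ 1 →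
               IsHamiltonianPath G × ∃[ σ ] IsSortedIndices σ × IsTheTopologicalSort G σ
  -- Without chains, `covers` leaves no vertex at all, and the path is the empty list.
  exact⇒path {G} record { chains = [] ; covers = covers } exact _ =
    ([] , path-ordering {G} covers′ exact′ , exact′) ,
    [] , path-sorted {G} covers′ exact′ , path-topologicalSort {G} covers′ exact′
    where
    covers′ : ∀ v → v ∈ []
    covers′ v with () ← covers v

    exact′ : ∀ u v → Arc G u v ⇔ Consecutive [] u v
    exact′ u with () ← covers u
  exact⇒path {G} record { chains = c ∷ [] ; covers = covers } exact _ =
    (toList c , path-ordering {G} covers′ exact′ , exact′) ,
    toList c , path-sorted {G} covers′ exact′ , path-topologicalSort {G} covers′ exact′
    where
    covers′ : ∀ v → v ∈ toList c
    covers′ v with here v∈ ← covers v = v∈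

    exact′ : ∀ u v → Arc G u v ⇔ Consecutive (toList c) u v
    exact′ u v = mk⇔ (λ arc → case to exact arc of λ { (here con) → con }) (from exact ∘ here)
  exact⇒path record { chains = _ ∷ _ ∷ _ } _ (s≤s ())

  -- Neighbours at cyclic distance one.

  Reach1 : Rel Vertex 0ℓ
  Reach1 = WithinReach 1

  -- Exchanging the ends negates the difference, so the offsets `+ 1` and `- 1` trade places.
  Reach1-sym : ∀ {u v} → Reach1 u v → Reach1 v u
  Reach1-sym {u} {v} (zero , inj₁ n∣) =
    zero , inj₂ (ℤ.∣⇒∣ᵤ (subst (+ n ℤ.∣_) (flip⁺ (+ toℕ v) (+ toℕ u)) (ℤ.∣m⇒∣-m (ℤ.∣ᵤ⇒∣ n∣))))
    where
    flip⁺ : ∀ x y → ℤ.- (x ℤ.- (y ℤ.+ + 1)) ≡ y ℤ.- (x ℤ.- + 1)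
    flip⁺ = solve-∀
  Reach1-sym {u} {v} (zero , inj₂ n∣) =
    zero , inj₁ (ℤ.∣⇒∣ᵤ (subst (+ n ℤ.∣_) (flip⁻ (+ toℕ v) (+ toℕ u)) (ℤ.∣m⇒∣-m (ℤ.∣ᵤ⇒∣ n∣))))
    where
    flip⁻ : ∀ x y → ℤ.- (x ℤ.- (y ℤ.- + 1)) ≡ y ℤ.- (x ℤ.+ + 1)
    flip⁻ = solve-∀

  -- Two indices below `n` differ by less than `n`, so a difference divisible by `n` is 0.
  ≡[mod]-unique : ∀ {x y : Vertex} z → + toℕ x ≡ z [mod n ] → + toℕ y ≡ z [mod n ] → x ≡ y
  ≡[mod]-unique {x} {y} z n∣x-z n∣y-z = Fin.toℕ-injective (ℤ.+-injective
    (ℤ.i-j≡0⇒i≡j (+ toℕ x) (+ toℕ y) (ℤ.∣i∣≡0⇒i≡0 (small ∣x-y∣<n n∣x-y))))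
    where
    difference : ∀ x y z → (x ℤ.- z) ℤ.- (y ℤ.- z) ≡ x ℤ.- y
    difference = solve-∀

    n∣x-y : n ℕ.∣ ℤ.∣ + toℕ x ℤ.- + toℕ y ∣
    n∣x-y = ℤ.∣⇒∣ᵤ (subst (+ n ℤ.∣_) (difference (+ toℕ x) (+ toℕ y) z)
      (ℤ.∣m∣n⇒∣m-n (ℤ.∣ᵤ⇒∣ {i = + toℕ x ℤ.- z} n∣x-z) (ℤ.∣ᵤ⇒∣ {i = + toℕ y ℤ.- z} n∣y-z)))

    ∣x-y∣<n : ℤ.∣ + toℕ x ℤ.- + toℕ y ∣ ℕ.< n
    ∣x-y∣<n = ℕ.≤-<-trans
      (ℕ.≤-trans (ℕ.≤-reflexive (cong ℤ.∣_∣ (ℤ.m-n≡m⊖n (toℕ x) (toℕ y))))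
                (ℤ.∣m⊝n∣≤m⊔n (toℕ x) (toℕ y)))
      (ℕ.⊔-lub (Fin.toℕ<n x) (Fin.toℕ<n y))

    small : ∀ {m} → m ℕ.< n → n ℕ.∣ m → m ≡ 0
    small {zero}  _   _   = refl
    small {suc m} m<n n∣m = ⊥-elim (ℕ.>⇒∤ m<n n∣m)

  -- Three neighbours of `u` share the two residues of `u + 1` and `u - 1`.
  Reach1-pigeonhole : ∀ {u x y z} → Reach1 u x → Reach1 u y → Reach1 u z →
                      x ≡ y ⊎ y ≡ z ⊎ x ≡ z
  Reach1-pigeonhole {u} (zero , p) (zero , q) (zero , r) = go p q r
    where
    next prev : ℤ
    next = + toℕ u ℤ.+ + 1
    prev = + toℕ u ℤ.- + 1

    IsNeighbour : Vertex → Set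
    IsNeighbour v = + toℕ v ≡ next [mod n ] ⊎ + toℕ v ≡ prev [mod n ]

    go : ∀ {x y z} → IsNeighbour x → IsNeighbour y → IsNeighbour z → x ≡ y ⊎ y ≡ z ⊎ x ≡ z
    go (inj₁ p) (inj₁ q) _        = inj₁ (≡[mod]-unique next p q)
    go (inj₂ p) (inj₂ q) _        = inj₁ (≡[mod]-unique prev p q)
    go (inj₁ p) (inj₂ q) (inj₁ r) = inj₂ (inj₂ (≡[mod]-unique next p r))
    go (inj₁ p) (inj₂ q) (inj₂ r) = inj₂ (inj₁ (≡[mod]-unique prev q r))
    go (inj₂ p) (inj₁ q) (inj₁ r) = inj₂ (inj₁ (≡[mod]-unique next q r))
    go (inj₂ p) (inj₁ q) (inj₂ r) = inj₂ (inj₂ (≡[mod]-unique prev p r))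

  module _ (L : List Vertex) where

    private
      F = dfsForest (correspondingGraph 1) L
      F-isForest = dfsForest-isForest (correspondingGraph 1) L

      adjacent : ∀ {u v} → SymClosure (Arc F) u v → Reach1 u v
      adjacent {u} {v} = λ where
          (fwd u→v) → within u→v
          (bwd v→u) → Reach1-sym {v} {u} (within v→u)
        where
        within : ∀ {u v} → Arc F u v → Reach1 u v
        within u→v = proj₂ (proj₂ (proj₂ (∈-filter⁻ (correspondingArc? 1)
          {xs = cartesianProduct (allFin n) (allFin n)} (IsForest.⊆G F-isForest u→v))))

    sorts-eventually : ∀ R → R ↭ roots F → ∃[ i ] 1 ≤ i ×
      let Fᵢ = proj₁ (rounds (mergeSubtrees F) R i) in
      IsHamiltonianPath Fᵢ × ∃[ σ ] IsSortedIndices σ × IsTheTopologicalSort Fᵢ σ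
    sorts-eventually R R↭ =
      -- The initial `k` chains meet the bound `suc k` with one to spare, which avoids a predecessor
      -- when `k` is 0. After `suc k` rounds `k ∸ suc k` is 0, so at most one chain is left.
      let D , exact , size = rounds-decompose D₀ k (ℕ.n≤1+n k) k in
      suc k , s≤s z≤n , exact⇒path D (λ {u} {v} → exact {u} {v})
        (ℕ.≤-trans size (s≤s (ℕ.≤-reflexive (ℕ.m≤n⇒m∸n≡0 (ℕ.n≤1+n k)))))
      where
      D₀ : Decomposition (mergeSubtrees F) R
      D₀ = SubtreeMerging.mergeSubtrees-decomposes F (IsForest.parent-unique F-isForest)
        (λ {u} p q r → Reach1-pigeonhole {u} (adjacent p) (adjacent q) (adjacent r)) R↭

      k = length (chains D₀)

theorem11 : ∀ {a ℓ₁ ℓ₂} (O : StrictTotalOrder a ℓ₁ ℓ₂) →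
    let module O = StrictTotalOrder O in
    ∀ (n : ℕ) (A : Fin n → O.Carrier) → Injective _≡_ O._≈_ A →
    let open ArraySort O A in
    ∀ (L : List (Fin n)) → IsOrdering L →
    let F = dfsForest (correspondingGraph 1) L
        H′ = mergeSubtrees F in
    ∀ (R : List (Fin n)) → R ↭ roots F →
    ∃[ i ] 1 ≤ i ×
      let Fᵢ = proj₁ (rounds H′ R i) in
      IsHamiltonianPath Fᵢ ×
      ∃[ σ ] IsSortedIndices σ × IsTheTopologicalSort Fᵢ σ
theorem11 O n A A-injective L _ = sorts-eventually O A A-injective L
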